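{- Almost every sparse paving matroid has a minor isomorphic to $\mathcal{W}^3$ or to $M(K_4)$; that is, if $s(n)$ is the number of sparse paving matroids on ground set $[n]$ and $s_{\mathcal{X}}(n)$ is the number of those having no minor isomorphic to $\mathcal{W}^3$ or $M(K_4)$, then $s_{\mathcal{X}}(n)=o(s(n))$ as $n\to\infty$.
   Context: A matroid is sparse paving if every nonspanning circuit is also a hyperplane. $\mathcal{W}^3$ is the rank-3 whirl: the rank-3 matroid on $\{a,b,c,d,e,f\}$ whose only dependent 3-sets are $\{a,b,c\},\{c,d,e\},\{e,f,a\}$. $M(K_4)$ is the cycle matroid of $K_4$; equivalently the rank-3 matroid on $\{a,b,c,d,e,f\}$ whose only dependent 3-sets are $\{a,b,c\},\{c,d,e\},\{e,f,a\},\{b,d,f\}$. Matroids are counted as labelled matroids on $[n]$. -}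

module Defs where

open import Data.Bool using (Bool; true; false; T; if_then_else_)
import Data.Bool.Properties as Bool
open import Data.Fin using (Fin; zero; suc; punchIn)
open import Data.Fin.Patterns
open import Data.Fin.Permutation using (Permutation; _⟨$⟩ʳ_; insert; remove; insert-remove; refute)
  renaming (_≈_ to _≈ₚ_)
import Data.Fin.Permutation as Perm
open import Data.Fin.Properties using (any?; all?)
open import Data.Fin.Subset
  using (Subset; inside; outside; _∈_; _∉_; _⊆_; _⊂_; _∪_; ⁅_⁆; ∣_∣; ⊤; ⊥)
open import Data.Fin.Subset.Properties using (anySubset?; _⊆?_; _⊂?_; _∈?_)
open import Data.Integer using (+_)
open import Data.List using (List; []; _∷_; length; filter; map; cartesianProductWith)
open import Data.List.Extrema.Nat using (max)
open import Data.List.Relation.Unary.Any using (here; there)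
open import Data.List.Relation.Unary.All as All using ()
open import Data.List.Relation.Unary.AllPairs as AllPairs using ()
import Data.List.Membership.DecPropositional as DecMembership
import Data.List.Membership.Setoid as Membership
import Data.List.Membership.Setoid.Properties as Membershipₚ
import Data.List.Relation.Unary.Unique.Setoid as Unique
import Data.List.Relation.Unary.Unique.Setoid.Properties as Uniqueₚ
open import Data.Nat using (ℕ; zero; suc; _≤_; _<_; _≤?_; _<?_; _≟_)
open import Data.Product using (∃; ∃-syntax; _×_; _,_; proj₁; proj₂)
open import Data.Rational as ℚ using (ℚ; 0ℚ; _/_)
open import Data.Sum using (_⊎_; inj₁; inj₂)
open import Data.Vec using ([]; _∷_; insertAt; tabulate; lookup)
open import Data.Vec.Properties using (≡-dec; tabulate-cong)
open import Function using (_∘_)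
open import Level using (0ℓ)
open import Relation.Binary.Bundles using (Setoid)
open import Relation.Binary.PropositionalEquality
  using (_≡_; _≗_; refl; sym; trans; cong; _→-setoid_)
open import Relation.Nullary using (¬_; Dec; yes; no; ¬?)
open import Relation.Nullary.Decidable
  using (map′; decidable-stable; T?; _×-dec_; _→-dec_; _⊎-dec_; ⌊_⌋)
open import Relation.Unary using (Pred; Decidable)

private
  variable
    k m n : ℕ

-- A family of subsets of [n] = Fin n, given by its characteristic function.
-- Matroids are presented by their families of independent sets.

SetSystem : ℕ → Set
SetSystem n = Subset n → Bool

Indep : SetSystem n → Subset n → Set
Indep M X = T (M X)

record IsMatroid (M : SetSystem n) : Set where
  field
    empty        : Indep M ⊥
    hereditary   : ∀ X Y → X ⊆ Y → Indep M Y → Indep M X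
    augmentation : ∀ X Y → Indep M X → Indep M Y → ∣ X ∣ < ∣ Y ∣ →
                   ∃[ e ] (e ∈ Y × e ∉ X × Indep M (X ∪ ⁅ e ⁆))

subsets : ∀ n → List (Subset n)
subsets zero    = [] ∷ []
subsets (suc n) = cartesianProductWith _∷_ (outside ∷ inside ∷ []) (subsets n)

rank : SetSystem n → Subset n → ℕ
rank {n} M X = max 0 (map ∣_∣ (filter (λ Y → Y ⊆? X ×-dec T? (M Y)) (subsets n)))

Circuit : SetSystem n → Subset n → Set
Circuit M C = ¬ Indep M C × (∀ X → X ⊂ C → Indep M X)

Spanning : SetSystem n → Subset n → Set
Spanning M X = rank M X ≡ rank M ⊤

Flat : SetSystem n → Subset n → Set
Flat M F = ∀ e → e ∉ F → rank M F < rank M (F ∪ ⁅ e ⁆)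

Hyperplane : SetSystem n → Subset n → Set
Hyperplane M H = Flat M H × suc (rank M H) ≡ rank M ⊤

IsSparsePaving : SetSystem n → Set
IsSparsePaving M =
  IsMatroid M × (∀ C → Circuit M C → ¬ Spanning M C → Hyperplane M C)

-- Deletion and contraction of one element; the remaining elements are
-- relabelled by Fin n in an order-preserving way, so that `insertAt X e outside`
-- is X itself and `insertAt X e inside` is X ∪ {e}.  Contracting a loop is the
-- same as deleting it.

infixl 7 _\\_ _//_

_\\_ : SetSystem (suc n) → Fin (suc n) → SetSystem n
(M \\ e) X = M (insertAt X e outside)

_//_ : SetSystem (suc n) → Fin (suc n) → SetSystem n
(M // e) X = if M ⁅ e ⁆ then M (insertAt X e inside) else M (insertAt X e outside)

infix 4 _≼_ _≅_

data _≼_ {k} (N : SetSystem k) : ∀ {n} → SetSystem n → Set where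
  ≼-refl   : N ≼ N
  delete   : ∀ {n} {M : SetSystem (suc n)} e → N ≼ M \\ e → N ≼ M
  contract : ∀ {n} {M : SetSystem (suc n)} e → N ≼ M // e → N ≼ M

preimage : Permutation m n → Subset n → Subset m
preimage π Y = tabulate (λ i → lookup Y (π ⟨$⟩ʳ i))

_≅_ : SetSystem m → SetSystem n → Set
_≅_ {m} {n} M N = ∃ λ (π : Permutation m n) → ∀ Y → M (preimage π Y) ≡ N Y

HasMinor : SetSystem m → SetSystem n → Set
HasMinor N M = ∃ λ k → ∃ λ (M′ : SetSystem k) → M′ ≼ M × M′ ≅ N

-- The rank-3 system on six elements whose dependent sets of size at most 3 are
-- exactly the given ones.

rank3 : List (Subset 6) → SetSystem 6
rank3 Ds X = ⌊ ∣ X ∣ ≤? 3 ×-dec ¬? (X ∈ˡ? Ds) ⌋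
  where open DecMembership (≡-dec {A = Bool} Bool._≟_) renaming (_∈?_ to _∈ˡ?_)

abc cde efa bdf : Subset 6
abc = ⁅ 0F ⁆ ∪ ⁅ 1F ⁆ ∪ ⁅ 2F ⁆
cde = ⁅ 2F ⁆ ∪ ⁅ 3F ⁆ ∪ ⁅ 4F ⁆
efa = ⁅ 4F ⁆ ∪ ⁅ 5F ⁆ ∪ ⁅ 0F ⁆
bdf = ⁅ 1F ⁆ ∪ ⁅ 3F ⁆ ∪ ⁅ 5F ⁆

𝒲³ : SetSystem 6
𝒲³ = rank3 (abc ∷ cde ∷ efa ∷ [])

M[K₄] : SetSystem 6
M[K₄] = rank3 (abc ∷ cde ∷ efa ∷ bdf ∷ [])

allSubsets? : {P : Pred (Subset n) 0ℓ} → Decidable P → Dec (∀ X → P X)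
allSubsets? P? =
  map′ (λ ¬∃ X → decidable-stable (P? X) (λ ¬p → ¬∃ (X , ¬p)))
       (λ ∀p (X , ¬p) → ¬p (∀p X))
       (¬? (anySubset? (¬? ∘ P?)))

isMatroid? : (M : SetSystem n) → Dec (IsMatroid M)
isMatroid? M =
  map′ (λ (p , q , r) → record { empty = p ; hereditary = q ; augmentation = r })
       (λ p → let open IsMatroid p in empty , hereditary , augmentation)
       (T? (M ⊥)
        ×-dec allSubsets? (λ X → allSubsets? λ Y →
                X ⊆? Y →-dec T? (M Y) →-dec T? (M X))
        ×-dec allSubsets? (λ X → allSubsets? λ Y →
                T? (M X) →-dec T? (M Y) →-dec ∣ X ∣ <? ∣ Y ∣ →-dec
                any? (λ e → e ∈? Y ×-dec ¬? (e ∈? X) ×-dec T? (M (X ∪ ⁅ e ⁆)))))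

circuit? : (M : SetSystem n) → Decidable (Circuit M)
circuit? M C = ¬? (T? (M C)) ×-dec allSubsets? (λ X → X ⊂? C →-dec T? (M X))

spanning? : (M : SetSystem n) → Decidable (Spanning M)
spanning? M X = rank M X ≟ rank M ⊤

hyperplane? : (M : SetSystem n) → Decidable (Hyperplane M)
hyperplane? M H =
  all? (λ e → ¬? (e ∈? H) →-dec rank M H <? rank M (H ∪ ⁅ e ⁆))
  ×-dec suc (rank M H) ≟ rank M ⊤

isSparsePaving? : Decidable (IsSparsePaving {n})
isSparsePaving? M =
  isMatroid? M
  ×-dec allSubsets? (λ C → circuit? M C →-dec ¬? (spanning? M C) →-dec hyperplane? M C)

anyPermutation? : ∀ {m n} {P : Pred (Permutation m n) 0ℓ} →
                  (∀ {π ρ} → π ≈ₚ ρ → P π → P ρ) → Decidable P → Dec (∃ P)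
anyPermutation? {zero}  {zero}  resp P? =
  map′ (Perm.id ,_) (λ (_ , p) → resp (λ ()) p) (P? Perm.id)
anyPermutation? {zero}  {suc n} resp P? = no (refute (λ ()) ∘ proj₁)
anyPermutation? {suc m} {zero}  resp P? = no (refute (λ ()) ∘ proj₁)
anyPermutation? {suc m} {suc n} resp P? =
  map′ (λ (j , π , p) → insert zero j π , p)
       (λ (π , p) → π ⟨$⟩ʳ zero , remove zero π ,
                    resp (λ i → sym (insert-remove zero π i)) p)
       (any? λ j → anyPermutation? (λ {π} {ρ} → resp ∘ insert-cong j π ρ)
                                   (λ π → P? (insert zero j π)))
  where
  insert-cong : ∀ j (π ρ : Permutation m n) → π ≈ₚ ρ → insert zero j π ≈ₚ insert zero j ρ
  insert-cong j π ρ π≈ρ zero    = refl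
  insert-cong j π ρ π≈ρ (suc i) = cong (punchIn j) (π≈ρ i)

_≅?_ : (M : SetSystem m) (N : SetSystem n) → Dec (M ≅ N)
M ≅? N = anyPermutation?
  (λ π≈ρ iso Y → trans (cong M (tabulate-cong (λ i → cong (lookup Y) (sym (π≈ρ i))))) (iso Y))
  (λ π → allSubsets? (λ Y → M (preimage π Y) Bool.≟ N Y))

hasMinor? : (N : SetSystem m) (M : SetSystem n) → Dec (HasMinor N M)
hasMinor? {n = zero} N M =
  map′ (λ iso → _ , M , ≼-refl , iso) (λ { (_ , _ , ≼-refl , iso) → iso }) (M ≅? N)
hasMinor? {n = suc n} N M =
  map′ (λ { (inj₁ iso)                             → _ , M , ≼-refl , iso
          ; (inj₂ (inj₁ (e , _ , M′ , M′≼ , iso))) → _ , M′ , delete e M′≼ , iso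
          ; (inj₂ (inj₂ (e , _ , M′ , M′≼ , iso))) → _ , M′ , contract e M′≼ , iso })
       (λ { (_ , _ , ≼-refl , iso)         → inj₁ iso
          ; (_ , M′ , delete e M′≼ , iso)   → inj₂ (inj₁ (e , _ , M′ , M′≼ , iso))
          ; (_ , M′ , contract e M′≼ , iso) → inj₂ (inj₂ (e , _ , M′ , M′≼ , iso)) })
       ((M ≅? N)
        ⊎-dec any? (λ e → hasMinor? N (M \\ e))
        ⊎-dec any? (λ e → hasMinor? N (M // e)))

-- Every family of subsets of [n] exactly once, up to pointwise equality; see
-- `∈-setSystems` and `setSystems-unique`.

extend : SetSystem n → SetSystem n → SetSystem (suc n)
extend F G (outside ∷ X) = F X
extend F G (inside  ∷ X) = G X

setSystems : ∀ n → List (SetSystem n)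
setSystems zero    = (λ _ → false) ∷ (λ _ → true) ∷ []
setSystems (suc n) = cartesianProductWith extend (setSystems n) (setSystems n)

SetSystemSetoid : ℕ → Setoid 0ℓ 0ℓ
SetSystemSetoid n = Subset n →-setoid Bool

∈-setSystems : ∀ n (M : SetSystem n) → Membership._∈_ (SetSystemSetoid n) M (setSystems n)
∈-setSystems zero M with M [] in eq
... | false = here λ { [] → eq }
... | true  = there (here λ { [] → eq })
∈-setSystems (suc n) M =
  Membershipₚ.∈-resp-≈ (SetSystemSetoid (suc n))
    (λ { (outside ∷ X) → refl ; (inside ∷ X) → refl })
    (Membershipₚ.∈-cartesianProductWith⁺
      (SetSystemSetoid n) (SetSystemSetoid n) (SetSystemSetoid (suc n))
      (λ { p q (outside ∷ X) → p X ; p q (inside ∷ X) → q X })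
      (∈-setSystems n (M ∘ (outside ∷_))) (∈-setSystems n (M ∘ (inside ∷_))))

setSystems-unique : ∀ n → Unique.Unique (SetSystemSetoid n) (setSystems n)
setSystems-unique zero =
  ((λ eq → false≢true (eq [])) All.∷ All.[]) AllPairs.∷ (All.[] AllPairs.∷ AllPairs.[])
  where
  false≢true : ¬ (false ≡ true)
  false≢true ()
setSystems-unique (suc n) =
  Uniqueₚ.cartesianProductWith⁺
    (SetSystemSetoid n) (SetSystemSetoid n) (SetSystemSetoid (suc n))
    extend
    (λ eq → eq ∘ (outside ∷_) , eq ∘ (inside ∷_))
    (setSystems-unique n) (setSystems-unique n)

numSparsePaving : ℕ → ℕ
numSparsePaving n = length (filter isSparsePaving? (setSystems n))

-- 𝒳 stands for the pair of excluded minors {𝒲³, M[K₄]}.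

numSparsePaving-𝒳 : ℕ → ℕ
numSparsePaving-𝒳 n = length (filter
  (λ M → isSparsePaving? M ×-dec ¬? (hasMinor? 𝒲³ M ⊎-dec hasMinor? M[K₄] M))
  (setSystems n))

infix 4 _=o_

_=o_ : (ℕ → ℕ) → (ℕ → ℕ) → Set
f =o g = ∀ (ε : ℚ) → 0ℚ ℚ.< ε →
         ∃[ n₀ ] (∀ n → n₀ ≤ n → + f n / 1 ℚ.≤ ε ℚ.* (+ g n / 1))

-- A sparse paving matroid of rank r is determined by its dependent r-sets, which form a
-- stable set 𝓕 of the Johnson graph J(n, r).  If an r-set X had three neighbours
-- X - xᵢ + bᵢ in 𝓕, then stability forces the xᵢ and the bᵢ to be distinct, and contracting
-- X - {x₁, x₂, x₃} and restricting to the six elements xᵢ, bᵢ yields 𝒲³ or M[K₄].  So without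
-- these minors every vertex has at most two neighbours in 𝓕, and counting edges gives
-- r (n - r) |𝓕| ≤ 2 (n C r): as n grows |𝓕| is O(B / n²), where B = n C ⌊n/2⌋, the ranks r
-- near 0 or n being negligible.  There are only 2 ^ O(B log n / n²) families that small,
-- whereas every subfamily of a Graham-Sloane stable set of size at least B / n is the family
-- of dependent r-sets of a sparse paving matroid, so there are at least 2 ^ (B / n) of these.

module Submission where

open import Defs
open import Data.Bool using (Bool; true; false; T; not; _∧_; if_then_else_)
open import Data.Bool.Properties using (T?; T-≡; T-∧)
import Data.Bool.Properties as Bool
open import Data.Fin using (Fin; zero; suc; toℕ; punchIn; punchOut; _≟_)
open import Data.Fin.Patterns
open import Data.Fin.Permutation using (permutation)
open import Data.Fin.Properties using (any?; all?; suc-injective; toℕ<n; toℕ-injective; punchOut-injective; punchIn-punchOut; punchOut-punchIn; punchInᵢ≢i; punchOut-cong)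
open import Data.Fin.Subset using (Subset; inside; outside; ∣_∣; _∈_; _∉_; _⊆_; _⊂_; _∪_; ⁅_⁆; ⊤; ⊥)
open import Data.Fin.Subset.Properties
open import Data.Integer as ℤ using (-[1+_]; +[1+_])
import Data.Integer.Properties as ℤ
open import Data.List using (List; []; _∷_; _++_; length; filter; map; cartesianProductWith)
open import Data.List.Extrema.Nat using (max≤v⁺; v≤max⁺)
import Data.List.Membership.DecPropositional as DecMembership
open import Data.List.Membership.Propositional using (lose) renaming (_∈_ to _∈ᴸ_)
open import Data.List.Membership.Propositional.Properties using (∈-filter⁺; ∈-map⁺; ∈-cartesianProductWith⁺)
open import Data.List.Properties using (map-++; filter-none)
open import Data.List.Relation.Unary.All as All using (All; []; _∷_)
import Data.List.Relation.Unary.All.Properties as All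
open import Data.List.Relation.Unary.AllPairs using (AllPairs; []; _∷_)
open import Data.List.Relation.Unary.Any using (Any; here; there; _─_)
import Data.List.Relation.Unary.Unique.Setoid.Properties as Unique
open import Data.Nat hiding (_≟_)
open import Data.Nat.Combinatorics using (_C_; nC1≡n; nCk≡nC[n∸k]; nCk+nC[k+1]≡[n+1]C[k+1])
open import Data.Nat.Combinatorics.Specification using (k>n⇒nCk≡0)
open import Data.Nat.Coprimality using (Coprime)
open import Data.Nat.DivMod using (_%_; _/_; m≡m%n+[m/n]*n; m%n<n; [m+kn]%n≡m%n; m<n⇒m%n≡m; m/n*n≤m; m*n/n≡m; /-monoˡ-≤)
open import Data.Nat.Induction using (<-rec)
open import Data.Nat.ListAction using () renaming (sum to sumᴸ)
open import Data.Nat.ListAction.Properties using (sum-++)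
open import Data.Nat.Properties as ℕ hiding (_≟_; suc-injective)
open import Data.Nat.Tactic.RingSolver using (solve-∀)
open import Data.Product using (∃-syntax; _×_; _,_; proj₁; proj₂)
open import Data.Product.Properties using () renaming (≡-dec to ×-≡-dec)
import Data.Rational as ℚ
import Data.Rational.Properties as ℚ
import Data.Rational.Unnormalised as ℚᵘ
import Data.Rational.Unnormalised.Properties as ℚᵘ
open import Data.Sum using (_⊎_; inj₁; inj₂)
open import Data.Vec using ([]; _∷_; lookup; _[_]≔_; insertAt; removeAt)
open import Data.Vec.Properties using (lookup∘update; lookup∘update′; lookup∘tabulate; tabulate∘lookup; tabulate-cong; []=⇒lookup; lookup⇒[]=; insertAt-lookup; insertAt-punchIn; insertAt-removeAt; removeAt-punchOut; ≡-dec)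
open import Function using (_∘_)
open import Function.Bundles using (Equivalence)
open import Function.Definitions using (Injective)
open import Level using (0ℓ)
open import Relation.Binary.Definitions using (tri<; tri≈; tri>)
open import Relation.Binary.PropositionalEquality using (_≡_; _≢_; refl; sym; trans; cong; cong₂; subst; _≗_; module ≡-Reasoning)
open import Relation.Nullary using (¬_; yes; no; ¬?; does; contradiction)
open import Relation.Nullary.Decidable using (_×-dec_; _⊎-dec_; _→-dec_; decidable-stable; toWitness; dec-true)
open import Relation.Unary using (Pred; Decidable)

open import Algebra.Properties.CommutativeMonoid.Sum +-0-commutativeMonoid using (sum; sum-cong-≗)
open import Algebra.Properties.Semiring.Sum +-*-semiring using (*-distribʳ-sum)

-- The obstacle is to count families with few members using neither entropy nor partial sums of
-- binomial coefficients. A Chernoff-style weighting does it: at most m^K (1 + 1/m)^(2^n) families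
-- have K or fewer members. With m = 2^(j+1) and n = j + e the second factor is at most 2^(2^e), so
-- only exponents of 2 remain to be compared. The first factor wants log m = O(log n). The second
-- must be 2^O(B / n²), and since 2^n is compared with B only through 2^n ≤ (n + 1) B, m has to be
-- of order n³ at least, rather than n². Hence j + 1 = 3L, where L stands in for the logarithm: n ≤
-- 2^L and (300 + D) L ≤ n.
--
-- Ranks up to n/6, and their complements, are negligible because binomial coefficients at least
-- double at every step up to n/3, so 2L steps gain a factor n².
--
-- On the six elements of the minor, stability decides every 3-set except bdf. That one undecided
-- set separates 𝒲³ from M(K₄), which is why the two are excluded together.

private
  variable
    A : Set
    k n : ℕ

-- Bernoulli's inequality and the growth of powers of two

-- This is (1 - 1/(1 + m))^h ≥ 1 - h/(1 + m), cleared of denominators and of subtraction.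
bernoulli : ∀ m h → suc m ^ suc h ≤ m ^ h * suc m + h * suc m ^ h
bernoulli m zero    = ≤-reflexive (solve m)
  where
  solve : ∀ m → (1 + m) * 1 ≡ 1 * (1 + m) + 0
  solve = solve-∀
bernoulli m (suc h) = begin
  suc m * suc m ^ suc h                       ≤⟨ *-monoʳ-≤ (suc m) (bernoulli m h) ⟩
  suc m * (m ^ h * suc m + h * suc m ^ h)     ≡⟨ expand m (m ^ h) h (suc m ^ h) ⟩
  m * m ^ h * suc m + m ^ h * suc m + h * (suc m * suc m ^ h)
    ≤⟨ +-monoˡ-≤ _ (+-monoʳ-≤ (m * m ^ h * suc m) (*-monoˡ-≤ (suc m) (^-monoˡ-≤ h (n≤1+n m)))) ⟩
  m * m ^ h * suc m + suc m ^ h * suc m + h * (suc m * suc m ^ h)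
    ≡⟨ regroup m (m ^ h) h (suc m ^ h) ⟩
  m * m ^ h * suc m + suc h * (suc m * suc m ^ h) ∎
  where
  open ≤-Reasoning
  expand : ∀ m a h b → (1 + m) * (a * (1 + m) + h * b)
           ≡ m * a * (1 + m) + a * (1 + m) + h * ((1 + m) * b)
  expand = solve-∀
  regroup : ∀ m a h b → m * a * (1 + m) + b * (1 + m) + h * ((1 + m) * b)
            ≡ m * a * (1 + m) + (1 + h) * ((1 + m) * b)
  regroup = solve-∀

-- At m = 2h Bernoulli's lower bound 1 - h/(1 + 2h) exceeds 1/2. In the usual form this reads (1 +
-- 1/m)^(m/2) ≤ 2.
[1+2h]^h≤2*[2h]^h : ∀ h → suc (2 * h) ^ h ≤ 2 * (2 * h) ^ h
[1+2h]^h≤2*[2h]^h h = *-cancelˡ-≤ (suc h) (+-cancelʳ-≤ (h * b) _ _ (begin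
  suc h * b + h * b               ≡⟨ left h b ⟩
  suc (2 * h) * b                 ≤⟨ bernoulli (2 * h) h ⟩
  a * suc (2 * h) + h * b         ≤⟨ +-monoˡ-≤ (h * b) (*-monoʳ-≤ a (n≤1+n (suc (2 * h)))) ⟩
  a * suc (suc (2 * h)) + h * b   ≡⟨ right h a b ⟩
  suc h * (2 * a) + h * b         ∎))
  where
  open ≤-Reasoning
  a = (2 * h) ^ h
  b = suc (2 * h) ^ h
  left : ∀ h b → (1 + h) * b + h * b ≡ (1 + 2 * h) * b
  left = solve-∀
  right : ∀ h a b → a * (2 + 2 * h) + h * b ≡ (1 + h) * (2 * a) + h * b
  right = solve-∀

^-distribʳ-* : ∀ e a b → (a * b) ^ e ≡ a ^ e * b ^ e
^-distribʳ-* zero    a b = refl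
^-distribʳ-* (suc e) a b =
  trans (cong (a * b *_) (^-distribʳ-* e a b)) ([m*n]*[o*p]≡[m*o]*[n*p] a b (a ^ e) (b ^ e))

-- The previous bound at h = 2^j, raised to the power 2^e. It caps the factor (1 + 1/m)^(2^n) that
-- comes out of `numSmall-bound`, for m = 2^(1+j) and n = j + e.
[1+2^1+j]^2^[j+e] : ∀ j e → suc (2 ^ suc j) ^ 2 ^ (j + e) ≤ 2 ^ 2 ^ e * (2 ^ suc j) ^ 2 ^ (j + e)
[1+2^1+j]^2^[j+e] j e = begin
  suc m ^ 2 ^ (j + e)               ≡⟨ cong (suc m ^_) (^-distribˡ-+-* 2 j e) ⟩
  suc m ^ (h * 2 ^ e)               ≡⟨ ^-*-assoc (suc m) h (2 ^ e) ⟨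
  (suc m ^ h) ^ 2 ^ e               ≤⟨ ^-monoˡ-≤ (2 ^ e) ([1+2h]^h≤2*[2h]^h h) ⟩
  (2 * m ^ h) ^ 2 ^ e               ≡⟨ ^-distribʳ-* (2 ^ e) 2 (m ^ h) ⟩
  2 ^ 2 ^ e * (m ^ h) ^ 2 ^ e       ≡⟨ cong (2 ^ 2 ^ e *_) (^-*-assoc m h (2 ^ e)) ⟩
  2 ^ 2 ^ e * m ^ (h * 2 ^ e)       ≡⟨ cong (λ x → 2 ^ 2 ^ e * m ^ x) (^-distribˡ-+-* 2 j e) ⟨
  2 ^ 2 ^ e * m ^ 2 ^ (j + e)       ∎
  where
  open ≤-Reasoning
  h = 2 ^ j
  m = 2 ^ suc j

n<2^n : ∀ n → n < 2 ^ n
n<2^n zero    = z<s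
n<2^n (suc n) = begin-strict
  suc n           ≡⟨ +-comm 1 n ⟩
  n + 1           <⟨ +-mono-<-≤ (n<2^n n) (m^n>0 2 n) ⟩
  2 ^ n + 2 ^ n   ≡⟨ cong (2 ^ n +_) (+-identityʳ (2 ^ n)) ⟨
  2 ^ suc n       ∎
  where open ≤-Reasoning

-- From 2a + 1 on, one more in the exponent adds a on the left and at least a on the right.
linear≤2^ : ∀ a d → a * (suc (2 * a) + d) ≤ 2 ^ (suc (2 * a) + d)
linear≤2^ a zero = begin
  a * (suc (2 * a) + 0)           ≡⟨ cong (a *_) (+-identityʳ (suc (2 * a))) ⟩
  a * suc (2 * a)                 ≤⟨ *-mono-≤ (<⇒≤ (n<2^n a)) (≤-trans (n≤1+n _) (≤-reflexive (double a))) ⟩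
  2 ^ a * (2 * suc a)             ≤⟨ *-monoʳ-≤ (2 ^ a) (*-monoʳ-≤ 2 (n<2^n a)) ⟩
  2 ^ a * (2 * 2 ^ a)             ≡⟨ ^-distribˡ-+-* 2 a (suc a) ⟨
  2 ^ (a + suc a)                 ≡⟨ cong (2 ^_) (index a) ⟩
  2 ^ (suc (2 * a) + 0)           ∎
  where
  open ≤-Reasoning
  double : ∀ a → 2 + 2 * a ≡ 2 * (1 + a)
  double = solve-∀
  index : ∀ a → a + (1 + a) ≡ 1 + 2 * a + 0
  index = solve-∀
linear≤2^ a (suc d) = begin
  a * (x + suc d)           ≡⟨ shift a (x + d) (+-suc x d) ⟩
  a * (x + d) + a           ≤⟨ +-mono-≤ (linear≤2^ a d) (≤-trans (<⇒≤ (n<2^n a)) (^-monoʳ-≤ 2 a≤)) ⟩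
  2 ^ (x + d) + 2 ^ (x + d) ≡⟨ cong (2 ^ (x + d) +_) (+-identityʳ _) ⟨
  2 ^ suc (x + d)           ≡⟨ cong (2 ^_) (+-suc x d) ⟨
  2 ^ (x + suc d)           ∎
  where
  open ≤-Reasoning
  x = suc (2 * a)
  a≤ : a ≤ x + d
  a≤ = ≤-trans (m≤m+n a (a + 0)) (≤-trans (n≤1+n _) (m≤m+n x d))
  shift : ∀ a y {z} → z ≡ suc y → a * z ≡ a * y + a
  shift a y refl = trans (*-suc a y) (+-comm a (a * y))

2^-bracket : ∀ n → ∃[ L ] (suc n ≤ 2 ^ L × 2 ^ L ≤ 2 * suc n)
2^-bracket zero    = 0 , ≤-refl , s≤s z≤n
2^-bracket (suc n) with 2^-bracket n
... | L , lo , hi with suc (suc n) ≤? 2 ^ L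
...   | yes p = L , p , ≤-trans hi (*-monoʳ-≤ 2 (n≤1+n (suc n)))
...   | no ¬p = suc L , 2+n≤ , *-monoʳ-≤ 2 (<⇒≤ (≰⇒> ¬p))
  where
  2+n≤ : suc (suc n) ≤ 2 ^ suc L
  2+n≤ = begin
    suc (suc n)         ≤⟨ s≤s (m≤m+n (suc n) n) ⟩
    suc (suc n + n)     ≡⟨ e n ⟩
    2 * suc n           ≤⟨ *-monoʳ-≤ 2 lo ⟩
    2 ^ suc L           ∎
    where
    open ≤-Reasoning
    e : ∀ n → 1 + (1 + n + n) ≡ 2 * (1 + n)
    e = solve-∀

-- `2^-bracket` gives only 2^L ≤ 2n, so `linear≤2^` is applied to 2b instead of b. The threshold
-- forces L ≥ x, where that linear bound is valid.
log-sublinear : ∀ b → ∃[ n₀ ] (∀ n → n₀ ≤ n → ∃[ L ] (n ≤ 2 ^ L × b * L ≤ n))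
log-sublinear b = suc (2 ^ x) , bound
  where
  a = 2 * b
  x = suc (2 * a)
  bound : ∀ n → suc (2 ^ x) ≤ n → ∃[ L ] (n ≤ 2 ^ L × b * L ≤ n)
  bound (suc n) 2^x<n with 2^-bracket n
  ... | L , lo , hi = L , lo , *-cancelˡ-≤ 2 (begin
    2 * (b * L)         ≡⟨ *-assoc 2 b L ⟨
    a * L               ≡⟨ cong (a *_) (m+[n∸m]≡n x≤L) ⟨
    a * (x + (L ∸ x))   ≤⟨ linear≤2^ a (L ∸ x) ⟩
    2 ^ (x + (L ∸ x))   ≡⟨ cong (2 ^_) (m+[n∸m]≡n x≤L) ⟩
    2 ^ L               ≤⟨ hi ⟩
    2 * suc n           ∎)
    where
    open ≤-Reasoning
    x≤L : x ≤ L
    x≤L = ≮⇒≥ λ L<x → <⇒≱ 2^x<n (≤-trans lo (^-monoʳ-≤ 2 (<⇒≤ L<x)))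

-- Binomial coefficients: ratios and the middle layer

-- The rule (k + 1) (n C (k + 1)) = (n - k) (n C k) with the subtraction moved across, so that
-- Pascal's rule proves it for all n and k.
[1+k]*nC[1+k]+k*nCk≡n*nCk : ∀ n k → suc k * (n C suc k) + k * (n C k) ≡ n * (n C k)
[1+k]*nC[1+k]+k*nCk≡n*nCk n       zero    rewrite nC1≡n n = solve n
  where
  solve : ∀ n → 1 * n + 0 ≡ n * 1
  solve = solve-∀
[1+k]*nC[1+k]+k*nCk≡n*nCk zero    (suc k) = cong₂ _+_ (*-zeroʳ k) (*-zeroʳ k)
[1+k]*nC[1+k]+k*nCk≡n*nCk (suc n) (suc k)
  rewrite sym (nCk+nC[k+1]≡[n+1]C[k+1] n (suc k)) | sym (nCk+nC[k+1]≡[n+1]C[k+1] n k) =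
  begin
    (2 + k) * (b + c) + (1 + k) * (a + b)
      ≡⟨ expand k a b c ⟩
    ((2 + k) * c + (1 + k) * b) + ((1 + k) * b + k * a) + a + b
      ≡⟨ cong₂ (λ x y → x + y + a + b) ([1+k]*nC[1+k]+k*nCk≡n*nCk n (suc k))
                                       ([1+k]*nC[1+k]+k*nCk≡n*nCk n k) ⟩
    n * b + n * a + a + b
      ≡⟨ collect n a b ⟩
    (1 + n) * (a + b) ∎
  where
  open ≡-Reasoning
  a = n C k
  b = n C suc k
  c = n C suc (suc k)
  expand : ∀ k a b c → (2 + k) * (b + c) + (1 + k) * (a + b)
           ≡ ((2 + k) * c + (1 + k) * b) + ((1 + k) * b + k * a) + a + b
  expand = solve-∀
  collect : ∀ n a b → n * b + n * a + a + b ≡ (1 + n) * (a + b)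
  collect = solve-∀

[1+k]*nC[1+k]≡[n∸k]*nCk : ∀ k l → suc k * ((k + l) C suc k) ≡ l * ((k + l) C k)
[1+k]*nC[1+k]≡[n∸k]*nCk k l = +-cancelʳ-≡ (k * c) _ _
  (trans ([1+k]*nC[1+k]+k*nCk≡n*nCk (k + l) k)
  (trans (*-distribʳ-+ c k l) (+-comm (k * c) (l * c))))
  where c = (k + l) C k

a*nCk≤nC[1+k] : ∀ a n k → a * suc k + k ≤ n → a * (n C k) ≤ n C suc k
a*nCk≤nC[1+k] a n k le = *-cancelˡ-≤ (suc k) (begin
  suc k * (a * (n C k))            ≡⟨ swap (suc k) a (n C k) ⟩
  a * suc k * (n C k)              ≤⟨ *-monoˡ-≤ (n C k) (m+n≤o⇒m≤o∸n (a * suc k) le) ⟩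
  (n ∸ k) * (n C k)                ≡⟨ step ⟨
  suc k * (n C suc k)              ∎)
  where
  open ≤-Reasoning
  swap : ∀ x a c → x * (a * c) ≡ a * x * c
  swap = solve-∀
  step : suc k * (n C suc k) ≡ (n ∸ k) * (n C k)
  step = subst (λ z → suc k * (z C suc k) ≡ (n ∸ k) * (z C k))
               (m+[n∸m]≡n (≤-trans (m≤n+m k (a * suc k)) le)) ([1+k]*nC[1+k]≡[n∸k]*nCk k (n ∸ k))

C-monoʳ-≤ : ∀ n k d → (k + d) + (k + d) ≤ n → n C k ≤ n C (k + d)
C-monoʳ-≤ n k zero    le rewrite +-identityʳ k = ≤-refl
C-monoʳ-≤ n k (suc d) le rewrite +-suc k d = ≤-trans
  (C-monoʳ-≤ n k d (≤-trans (+-mono-≤ (n≤1+n (k + d)) (n≤1+n (k + d))) le))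
  (≤-trans (≤-reflexive (sym (*-identityˡ _)))
           (a*nCk≤nC[1+k] 1 n (k + d)
             (≤-trans (+-mono-≤ (≤-reflexive (*-identityˡ (suc (k + d)))) (n≤1+n (k + d))) le)))

-- The ratio of consecutive coefficients, (n - k) / (k + 1), stays at least 2 up to n/3.
2^e*nCk≤nC[k+e] : ∀ n k e → 3 * (k + e) ≤ n → 2 ^ e * (n C k) ≤ n C (k + e)
2^e*nCk≤nC[k+e] n k zero    le rewrite +-identityʳ k = ≤-reflexive (+-identityʳ _)
2^e*nCk≤nC[k+e] n k (suc e) le rewrite +-suc k e = begin
  2 * 2 ^ e * (n C k)     ≡⟨ *-assoc 2 (2 ^ e) (n C k) ⟩
  2 * (2 ^ e * (n C k))   ≤⟨ *-monoʳ-≤ 2 (2^e*nCk≤nC[k+e] n k e (≤-trans (*-monoʳ-≤ 3 (n≤1+n (k + e))) le)) ⟩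
  2 * (n C (k + e))       ≤⟨ a*nCk≤nC[1+k] 2 n (k + e) (≤-trans (bound (k + e)) le) ⟩
  n C suc (k + e)         ∎
  where
  open ≤-Reasoning
  bound : ∀ x → 2 * suc x + x ≤ 3 * suc x
  bound x = ≤-trans (+-monoʳ-≤ (2 * suc x) (n≤1+n x)) (≤-reflexive (e₁ x))
    where
    e₁ : ∀ x → 2 * (1 + x) + (1 + x) ≡ 3 * (1 + x)
    e₁ = solve-∀

nCk≤nC⌊n/2⌋-lower : ∀ n k → k ≤ ⌊ n /2⌋ → n C k ≤ n C ⌊ n /2⌋
nCk≤nC⌊n/2⌋-lower n k k≤h = subst (λ z → n C k ≤ n C z) (m+[n∸m]≡n k≤h)
  (C-monoʳ-≤ n k (⌊ n /2⌋ ∸ k)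
    (subst (λ z → z + z ≤ n) (sym (m+[n∸m]≡n k≤h))
      (≤-trans (+-monoʳ-≤ ⌊ n /2⌋ (⌊n/2⌋≤⌈n/2⌉ n)) (≤-reflexive (⌊n/2⌋+⌈n/2⌉≡n n)))))

nCk≤nC⌊n/2⌋ : ∀ n k → n C k ≤ n C ⌊ n /2⌋
nCk≤nC⌊n/2⌋ n k with k ≤? ⌊ n /2⌋ | k ≤? n
... | yes k≤h | _       = nCk≤nC⌊n/2⌋-lower n k k≤h
... | no _    | no k≰n  = ≤-trans (≤-reflexive (k>n⇒nCk≡0 (≰⇒> k≰n))) z≤n
... | no k≰h  | yes k≤n =
  ≤-trans (≤-reflexive (nCk≡nC[n∸k] k≤n)) (nCk≤nC⌊n/2⌋-lower n (n ∸ k) n∸k≤h)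
  where
  ⌈n/2⌉≤1+⌊n/2⌋ : ∀ n → ⌈ n /2⌉ ≤ suc ⌊ n /2⌋
  ⌈n/2⌉≤1+⌊n/2⌋ zero          = z≤n
  ⌈n/2⌉≤1+⌊n/2⌋ (suc zero)    = s≤s z≤n
  ⌈n/2⌉≤1+⌊n/2⌋ (suc (suc n)) = s≤s (⌈n/2⌉≤1+⌊n/2⌋ n)
  n∸k≤h : n ∸ k ≤ ⌊ n /2⌋
  n∸k≤h = m≤n+o⇒m∸n≤o n k (begin
    n                     ≡⟨ ⌊n/2⌋+⌈n/2⌉≡n n ⟨
    ⌊ n /2⌋ + ⌈ n /2⌉     ≡⟨ +-comm ⌊ n /2⌋ ⌈ n /2⌉ ⟩
    ⌈ n /2⌉ + ⌊ n /2⌋     ≤⟨ +-monoˡ-≤ ⌊ n /2⌋ (≤-trans (⌈n/2⌉≤1+⌊n/2⌋ n) (≰⇒> k≰h)) ⟩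
    k + ⌊ n /2⌋           ∎)
    where open ≤-Reasoning

-- Sums over indices and subsets; double counting of exchanges

𝟙 : Bool → ℕ
𝟙 b = if b then 1 else 0

𝟙≤1 : ∀ b → 𝟙 b ≤ 1
𝟙≤1 true  = ≤-refl
𝟙≤1 false = z≤n

sum-mono-≤ : {f g : Fin n → ℕ} → (∀ i → f i ≤ g i) → sum f ≤ sum g
sum-mono-≤ {zero}  f≤g = z≤n
sum-mono-≤ {suc n} f≤g = +-mono-≤ (f≤g zero) (sum-mono-≤ (f≤g ∘ suc))

sum-const : ∀ n c → sum {n} (λ _ → c) ≡ n * c
sum-const zero    c = refl
sum-const (suc n) c = cong (c +_) (sum-const n c)

-- Turns arithmetic back into combinatorics: with k = 3 it extracts from a neighbour count above two
-- the three distinct elements that `triangle⇒minor` needs.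
support : (f : Fin n → ℕ) → (∀ i → f i ≤ 1) → ∀ k → k ≤ sum f →
          ∃[ g ] (Injective {A = Fin k} {B = Fin n} _≡_ _≡_ g × (∀ j → 0 < f (g j)))
support         f f≤1 zero    _ = (λ ()) , (λ {}) , λ ()
support {zero}  f f≤1 (suc k) ()
support {suc n} f f≤1 (suc k) k≤ with f zero in eq | f≤1 zero
... | zero | _ with support (f ∘ suc) (f≤1 ∘ suc) (suc k) k≤
...   | g , g-inj , g-pos = suc ∘ g , g-inj ∘ suc-injective , g-pos
support {suc n} f f≤1 (suc k) k≤ | suc .0 | s≤s z≤n with support (f ∘ suc) (f≤1 ∘ suc) k (s≤s⁻¹ k≤)
...   | g , g-inj , g-pos = g′ , g′-inj , g′-pos
  where
  g′ : Fin (suc k) → Fin (suc n)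
  g′ zero    = zero
  g′ (suc j) = suc (g j)
  g′-inj : Injective _≡_ _≡_ g′
  g′-inj {zero}  {zero}  _ = refl
  g′-inj {suc i} {suc j} p = cong suc (g-inj (suc-injective p))
  g′-pos : ∀ j → 0 < f (g′ j)
  g′-pos zero    = ≤-reflexive (sym eq)
  g′-pos (suc j) = g-pos j

sum≤n*max : (f : Fin (suc n) → ℕ) → ∃[ j ] (sum f ≤ suc n * f j)
sum≤n*max {zero}  f = zero , ≤-refl
sum≤n*max {suc n} f with sum≤n*max (f ∘ suc)
... | j , le with ≤-total (f zero) (f (suc j))
...   | inj₁ f₀≤ = suc j , +-mono-≤ f₀≤ le
...   | inj₂ ≤f₀ = zero  , +-monoʳ-≤ (f zero) (≤-trans le (*-monoʳ-≤ (suc n) ≤f₀))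

-- The recursion on the first coordinate has the shape of Pascal's rule and of `extend`, so
-- `cosize (extend F G)` splits as `cosize F + cosize G` by unfolding.
∑ˢ : (Subset n → ℕ) → ℕ
∑ˢ {zero}  f = f []
∑ˢ {suc n} f = ∑ˢ (f ∘ (outside ∷_)) + ∑ˢ (f ∘ (inside ∷_))

∑ˢ-cong : {f g : Subset n → ℕ} → f ≗ g → ∑ˢ f ≡ ∑ˢ g
∑ˢ-cong {zero}  f≗g = f≗g []
∑ˢ-cong {suc n} f≗g = cong₂ _+_ (∑ˢ-cong (f≗g ∘ (outside ∷_))) (∑ˢ-cong (f≗g ∘ (inside ∷_)))

∑ˢ-mono-≤ : {f g : Subset n → ℕ} → (∀ X → f X ≤ g X) → ∑ˢ f ≤ ∑ˢ g
∑ˢ-mono-≤ {zero}  f≤g = f≤g []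
∑ˢ-mono-≤ {suc n} f≤g = +-mono-≤ (∑ˢ-mono-≤ (f≤g ∘ (outside ∷_))) (∑ˢ-mono-≤ (f≤g ∘ (inside ∷_)))

∑ˢ-distrib-+ : ∀ {n} (f g : Subset n → ℕ) → ∑ˢ (λ X → f X + g X) ≡ ∑ˢ f + ∑ˢ g
∑ˢ-distrib-+ {zero}  f g = refl
∑ˢ-distrib-+ {suc n} f g
  rewrite ∑ˢ-distrib-+ (f ∘ (outside ∷_)) (g ∘ (outside ∷_))
        | ∑ˢ-distrib-+ (f ∘ (inside ∷_)) (g ∘ (inside ∷_)) =
  interchange (∑ˢ (f ∘ (outside ∷_))) (∑ˢ (g ∘ (outside ∷_)))
              (∑ˢ (f ∘ (inside ∷_))) (∑ˢ (g ∘ (inside ∷_)))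
  where
  interchange : ∀ a b c d → a + b + (c + d) ≡ a + c + (b + d)
  interchange = solve-∀

∑ˢ-distribˡ-* : ∀ {n} c (f : Subset n → ℕ) → ∑ˢ (λ X → c * f X) ≡ c * ∑ˢ f
∑ˢ-distribˡ-* {zero}  c f = refl
∑ˢ-distribˡ-* {suc n} c f =
  trans (cong₂ _+_ (∑ˢ-distribˡ-* c (f ∘ (outside ∷_))) (∑ˢ-distribˡ-* c (f ∘ (inside ∷_))))
        (sym (*-distribˡ-+ c (∑ˢ (f ∘ (outside ∷_))) _))

∑ˢ-const : ∀ n c → ∑ˢ {n} (λ _ → c) ≡ 2 ^ n * c
∑ˢ-const zero    c = sym (+-identityʳ c)
∑ˢ-const (suc n) c rewrite ∑ˢ-const n c = e (2 ^ n) c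
  where
  e : ∀ x c → x * c + x * c ≡ 2 * x * c
  e = solve-∀

∑ˢ-∑-comm : ∀ {n m} (f : Subset n → Fin m → ℕ) →
            ∑ˢ (λ X → sum (f X)) ≡ sum (λ i → ∑ˢ (λ X → f X i))
∑ˢ-∑-comm {n} {zero} f = trans (∑ˢ-const n 0) (*-zeroʳ (2 ^ n))
∑ˢ-∑-comm {n} {suc m} f =
  trans (∑ˢ-distrib-+ (λ X → f X zero) (λ X → sum (f X ∘ suc)))
        (cong (∑ˢ (λ X → f X zero) +_) (∑ˢ-∑-comm (λ X → f X ∘ suc)))

∑ˢ-layer : ∀ n k → ∑ˢ {n} (λ X → 𝟙 (∣ X ∣ ≡ᵇ k)) ≡ n C k
∑ˢ-layer zero    zero    = refl
∑ˢ-layer zero    (suc k) = refl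
∑ˢ-layer (suc n) zero    =
  cong₂ _+_ (∑ˢ-layer n zero) (trans (∑ˢ-const n 0) (*-zeroʳ (2 ^ n)))
∑ˢ-layer (suc n) (suc k) =
  trans (cong₂ _+_ (∑ˢ-layer n (suc k)) (∑ˢ-layer n k))
        (trans (+-comm (n C suc k) (n C k)) (nCk+nC[k+1]≡[n+1]C[k+1] n k))

side : Bool → Bool → Bool
side true  c = c
side false c = not c

-- Flipping coordinate i is a bijection between the subsets with i and those without; b selects the
-- direction, and `side b` tests a bit for equality with b.
∑ˢ-flip : ∀ {n} b (i : Fin n) (h : Subset n → ℕ) →
          ∑ˢ (λ X → 𝟙 (side b (lookup X i)) * h (X [ i ]≔ not b)) ≡
          ∑ˢ (λ X → 𝟙 (side (not b) (lookup X i)) * h X)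
∑ˢ-flip {suc n} false zero h = +-comm (∑ˢ (λ X → 1 * h (inside ∷ X))) (∑ˢ {n} (λ X → 0))
∑ˢ-flip {suc n} true  zero h = +-comm (∑ˢ {n} (λ X → 0)) (∑ˢ (λ X → 1 * h (outside ∷ X)))
∑ˢ-flip b (suc i) h = cong₂ _+_ (∑ˢ-flip b i (h ∘ (outside ∷_))) (∑ˢ-flip b i (h ∘ (inside ∷_)))

exchange : Subset n → Fin n → Fin n → Subset n
exchange T x b = T [ x ]≔ outside [ b ]≔ inside

∑-∈ : (X : Subset n) → sum (λ i → 𝟙 (lookup X i)) ≡ ∣ X ∣
∑-∈ []            = refl
∑-∈ (outside ∷ X) = ∑-∈ X
∑-∈ (inside ∷ X)  = cong suc (∑-∈ X)

∑-∉ : (X : Subset n) → sum (λ i → 𝟙 (not (lookup X i))) ≡ n ∸ ∣ X ∣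
∑-∉ X = trans (sym (m+n∸n≡m _ ∣ X ∣)) (cong (_∸ ∣ X ∣) (go X))
  where
  go : ∀ {n} (X : Subset n) → sum (λ i → 𝟙 (not (lookup X i))) + ∣ X ∣ ≡ n
  go []            = refl
  go (outside ∷ X) = cong suc (go X)
  go (inside ∷ X)  = trans (+-suc _ ∣ X ∣) (cong suc (go X))

𝟙*𝟙-not : ∀ c y → 𝟙 c * (𝟙 (not c) * y) ≡ 0
𝟙*𝟙-not true  y = refl
𝟙*𝟙-not false y = refl

-- An exchange is a flip at x followed by one at b, hence a bijection from the sets with x and
-- without b to those with b and without x. For x = b both sides vanish.
∑ˢ-exchange : (φ : Subset n → ℕ) (x b : Fin n) →
  ∑ˢ (λ T → 𝟙 (lookup T x) * (𝟙 (not (lookup T b)) * φ (exchange T x b))) ≡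
  ∑ˢ (λ F → 𝟙 (lookup F b) * (𝟙 (not (lookup F x)) * φ F))
∑ˢ-exchange φ x b with x ≟ b
... | yes refl = ∑ˢ-cong λ T → trans (𝟙*𝟙-not (lookup T x) _) (sym (𝟙*𝟙-not (lookup T x) _))
... | no x≢b = begin
  ∑ˢ (λ T → 𝟙 (lookup T x) * (𝟙 (not (lookup T b)) * φ (exchange T x b)))
    ≡⟨ ∑ˢ-cong (λ T → cong (λ z → 𝟙 (lookup T x) * (𝟙 (not z) * φ (exchange T x b)))
                           (sym (lookup∘update′ (x≢b ∘ sym) T outside))) ⟩
  ∑ˢ (λ T → 𝟙 (lookup T x) * h (T [ x ]≔ outside))
    ≡⟨ ∑ˢ-flip true x h ⟩
  ∑ˢ (λ Y → 𝟙 (not (lookup Y x)) * h Y)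
    ≡⟨ ∑ˢ-cong (λ Y → rotate (𝟙 (not (lookup Y x))) (𝟙 (not (lookup Y b))) (φ (Y [ b ]≔ inside))) ⟩
  ∑ˢ (λ Y → 𝟙 (not (lookup Y b)) * (𝟙 (not (lookup Y x)) * φ (Y [ b ]≔ inside)))
    ≡⟨ ∑ˢ-cong (λ Y → cong (λ z → 𝟙 (not (lookup Y b)) * (𝟙 (not z) * φ (Y [ b ]≔ inside)))
                           (sym (lookup∘update′ x≢b Y inside))) ⟩
  ∑ˢ (λ Y → 𝟙 (not (lookup Y b)) * g (Y [ b ]≔ inside))
    ≡⟨ ∑ˢ-flip false b g ⟩
  ∑ˢ (λ F → 𝟙 (lookup F b) * g F) ∎
  where
  open ≡-Reasoning
  h g : Subset _ → ℕ
  h Y = 𝟙 (not (lookup Y b)) * φ (Y [ b ]≔ inside)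
  g F = 𝟙 (not (lookup F x)) * φ F
  rotate : ∀ a b c → a * (b * c) ≡ b * (a * c)
  rotate = solve-∀

-- Double counting of Johnson graph edges, weighted at the far end: F arises once for each choice of
-- a gained b in F and a lost x outside F.
∑ˢ-exchanges : (φ : Subset n → ℕ) →
  ∑ˢ (λ T → sum λ x → sum λ b → 𝟙 (lookup T x) * (𝟙 (not (lookup T b)) * φ (exchange T x b))) ≡
  ∑ˢ (λ F → (n ∸ ∣ F ∣) * ∣ F ∣ * φ F)
∑ˢ-exchanges {n} φ = begin
  ∑ˢ (λ T → sum λ x → sum λ b → l T x b)       ≡⟨ ∑ˢ-∑-comm (λ T x → sum (l T x)) ⟩
  sum (λ x → ∑ˢ (λ T → sum λ b → l T x b))     ≡⟨ sum-cong-≗ (λ x → ∑ˢ-∑-comm (λ T → l T x)) ⟩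
  sum (λ x → sum λ b → ∑ˢ (λ T → l T x b))     ≡⟨ sum-cong-≗ (λ x → sum-cong-≗ (∑ˢ-exchange φ x)) ⟩
  sum (λ x → sum λ b → ∑ˢ (λ F → u F x b))     ≡⟨ sum-cong-≗ (λ x → ∑ˢ-∑-comm (λ F → u F x)) ⟨
  sum (λ x → ∑ˢ (λ F → sum λ b → u F x b))     ≡⟨ ∑ˢ-∑-comm (λ F x → sum (u F x)) ⟨
  ∑ˢ (λ F → sum λ x → sum λ b → u F x b)       ≡⟨ ∑ˢ-cong factor ⟩
  ∑ˢ (λ F → (n ∸ ∣ F ∣) * ∣ F ∣ * φ F)         ∎
  where
  open ≡-Reasoning
  l u : Subset n → Fin n → Fin n → ℕ
  l T x b = 𝟙 (lookup T x) * (𝟙 (not (lookup T b)) * φ (exchange T x b))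
  u F x b = 𝟙 (lookup F b) * (𝟙 (not (lookup F x)) * φ F)
  rotate : ∀ a b c → a * (b * c) ≡ b * (a * c)
  rotate = solve-∀
  factor : ∀ F → sum (λ x → sum λ b → u F x b) ≡ (n ∸ ∣ F ∣) * ∣ F ∣ * φ F
  factor F = begin
    sum (λ x → sum λ b → 𝟙 (lookup F b) * (𝟙 (not (lookup F x)) * φ F))
      ≡⟨ sum-cong-≗ (λ x → sym (*-distribʳ-sum (𝟙 (not (lookup F x)) * φ F) (λ b → 𝟙 (lookup F b)))) ⟩
    sum (λ x → sum (λ b → 𝟙 (lookup F b)) * (𝟙 (not (lookup F x)) * φ F))
      ≡⟨ sum-cong-≗ (λ x → cong (_* (𝟙 (not (lookup F x)) * φ F)) (∑-∈ F)) ⟩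
    sum (λ x → ∣ F ∣ * (𝟙 (not (lookup F x)) * φ F))
      ≡⟨ sum-cong-≗ (λ x → rotate ∣ F ∣ (𝟙 (not (lookup F x))) (φ F)) ⟩
    sum (λ x → 𝟙 (not (lookup F x)) * (∣ F ∣ * φ F))
      ≡⟨ *-distribʳ-sum (∣ F ∣ * φ F) (λ x → 𝟙 (not (lookup F x))) ⟨
    sum (λ x → 𝟙 (not (lookup F x))) * (∣ F ∣ * φ F)
      ≡⟨ cong (_* (∣ F ∣ * φ F)) (∑-∉ F) ⟩
    (n ∸ ∣ F ∣) * (∣ F ∣ * φ F)
      ≡⟨ *-assoc (n ∸ ∣ F ∣) ∣ F ∣ (φ F) ⟨
    (n ∸ ∣ F ∣) * ∣ F ∣ * φ F ∎

-- Counting families by their number of members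

size : SetSystem n → ℕ
size 𝓕 = ∑ˢ (𝟙 ∘ 𝓕)

cosize : SetSystem n → ℕ
cosize 𝓕 = ∑ˢ (𝟙 ∘ not ∘ 𝓕)

size+cosize≡2^n : (𝓕 : SetSystem n) → size 𝓕 + cosize 𝓕 ≡ 2 ^ n
size+cosize≡2^n {n} 𝓕 = begin
  size 𝓕 + cosize 𝓕                          ≡⟨ ∑ˢ-distrib-+ (𝟙 ∘ 𝓕) (𝟙 ∘ not ∘ 𝓕) ⟨
  ∑ˢ (λ X → 𝟙 (𝓕 X) + 𝟙 (not (𝓕 X)))         ≡⟨ ∑ˢ-cong (λ X → one (𝓕 X)) ⟩
  ∑ˢ {n} (λ _ → 1)                           ≡⟨ ∑ˢ-const n 1 ⟩
  2 ^ n * 1                                  ≡⟨ *-identityʳ (2 ^ n) ⟩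
  2 ^ n                                      ∎
  where
  open ≡-Reasoning
  one : ∀ b → 𝟙 b + 𝟙 (not b) ≡ 1
  one true  = refl
  one false = refl

sum-cartesianProductWith : {B D : Set} (f : A → B → D) (w : D → ℕ) (u : A → ℕ) (v : B → ℕ) →
  (∀ x y → w (f x y) ≡ u x * v y) → ∀ xs ys →
  sumᴸ (map w (cartesianProductWith f xs ys)) ≡ sumᴸ (map u xs) * sumᴸ (map v ys)
sum-cartesianProductWith f w u v w≡ []       ys = refl
sum-cartesianProductWith f w u v w≡ (x ∷ xs) ys = begin
  sumᴸ (map w (map (f x) ys ++ rest))
    ≡⟨ cong sumᴸ (map-++ w (map (f x) ys) rest) ⟩
  sumᴸ (map w (map (f x) ys) ++ map w rest)
    ≡⟨ sum-++ (map w (map (f x) ys)) (map w rest) ⟩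
  sumᴸ (map w (map (f x) ys)) + sumᴸ (map w rest)
    ≡⟨ cong₂ _+_ (row ys) (sum-cartesianProductWith f w u v w≡ xs ys) ⟩
  u x * sumᴸ (map v ys) + sumᴸ (map u xs) * sumᴸ (map v ys)
    ≡⟨ *-distribʳ-+ (sumᴸ (map v ys)) (u x) (sumᴸ (map u xs)) ⟨
  (u x + sumᴸ (map u xs)) * sumᴸ (map v ys) ∎
  where
  open ≡-Reasoning
  rest = cartesianProductWith f xs ys
  row : ∀ ys → sumᴸ (map w (map (f x) ys)) ≡ u x * sumᴸ (map v ys)
  row []       = sym (*-zeroʳ (u x))
  row (y ∷ ys) = trans (cong₂ _+_ (w≡ x y) (row ys)) (sym (*-distribˡ-+ (u x) (v y) _))

-- The sum factorises over the 2^n subsets, each contributing m for being left out plus 1 for being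
-- a member.
sum-m^cosize : ∀ m n → sumᴸ (map (λ 𝓕 → m ^ cosize 𝓕) (setSystems n)) ≡ suc m ^ 2 ^ n
sum-m^cosize m zero    = base m
  where
  base : ∀ m → m * 1 + (1 + 0) ≡ (1 + m) * 1
  base = solve-∀
sum-m^cosize m (suc n) = begin
  sumᴸ (map (λ 𝓕 → m ^ cosize 𝓕) (setSystems (suc n)))
    ≡⟨ sum-cartesianProductWith extend _ (λ 𝓕 → m ^ cosize 𝓕) (λ 𝓖 → m ^ cosize 𝓖)
         (λ 𝓕 𝓖 → ^-distribˡ-+-* m (cosize 𝓕) (cosize 𝓖)) (setSystems n) (setSystems n) ⟩
  sumᴸ (map (λ 𝓕 → m ^ cosize 𝓕) (setSystems n)) * sumᴸ (map (λ 𝓕 → m ^ cosize 𝓕) (setSystems n))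
    ≡⟨ cong₂ _*_ (sum-m^cosize m n) (sum-m^cosize m n) ⟩
  suc m ^ 2 ^ n * suc m ^ 2 ^ n
    ≡⟨ ^-distribˡ-+-* (suc m) (2 ^ n) (2 ^ n) ⟨
  suc m ^ (2 ^ n + 2 ^ n)
    ≡⟨ cong (λ z → suc m ^ (2 ^ n + z)) (+-identityʳ (2 ^ n)) ⟨
  suc m ^ 2 ^ suc n ∎
  where open ≡-Reasoning

length-filter-*-≤ : {P : Pred A 0ℓ} (P? : Decidable P) (w : A → ℕ) (c : ℕ) →
  (∀ x → P x → c ≤ w x) → ∀ xs → length (filter P? xs) * c ≤ sumᴸ (map w xs)
length-filter-*-≤ P? w c c≤w []       = z≤n
length-filter-*-≤ P? w c c≤w (x ∷ xs) with P? x
... | yes p = +-mono-≤ (c≤w x p) (length-filter-*-≤ P? w c c≤w xs)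
... | no  _ = ≤-trans (length-filter-*-≤ P? w c c≤w xs) (m≤n+m _ (w x))

sum-*ˡ : ∀ c (w : A → ℕ) xs → sumᴸ (map (λ x → c * w x) xs) ≡ c * sumᴸ (map w xs)
sum-*ˡ c w []       = sym (*-zeroʳ c)
sum-*ˡ c w (x ∷ xs) = trans (cong (c * w x +_) (sum-*ˡ c w xs)) (sym (*-distribˡ-+ c (w x) _))

-- Weighting 𝓕 by m ^ cosize 𝓕 penalises each member by a factor 1 / m.
numSmall-bound : ∀ m K n .{{_ : NonZero m}} →
  length (filter (λ 𝓕 → size 𝓕 ≤? K) (setSystems n)) * m ^ 2 ^ n ≤ m ^ K * suc m ^ 2 ^ n
numSmall-bound m K n = begin
  length (filter (λ 𝓕 → size 𝓕 ≤? K) (setSystems n)) * m ^ 2 ^ n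
    ≤⟨ length-filter-*-≤ (λ 𝓕 → size 𝓕 ≤? K) (λ 𝓕 → m ^ K * m ^ cosize 𝓕) (m ^ 2 ^ n) heavy (setSystems n) ⟩
  sumᴸ (map (λ 𝓕 → m ^ K * m ^ cosize 𝓕) (setSystems n))
    ≡⟨ sum-*ˡ (m ^ K) (λ 𝓕 → m ^ cosize 𝓕) (setSystems n) ⟩
  m ^ K * sumᴸ (map (λ 𝓕 → m ^ cosize 𝓕) (setSystems n))
    ≡⟨ cong (m ^ K *_) (sum-m^cosize m n) ⟩
  m ^ K * suc m ^ 2 ^ n ∎
  where
  open ≤-Reasoning
  heavy : ∀ 𝓕 → size 𝓕 ≤ K → m ^ 2 ^ n ≤ m ^ K * m ^ cosize 𝓕
  heavy 𝓕 ≤K = begin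
    m ^ 2 ^ n                  ≡⟨ cong (m ^_) (size+cosize≡2^n 𝓕) ⟨
    m ^ (size 𝓕 + cosize 𝓕)    ≤⟨ ^-monoʳ-≤ m (+-monoˡ-≤ (cosize 𝓕) ≤K) ⟩
    m ^ (K + cosize 𝓕)         ≡⟨ ^-distribˡ-+-* m K (cosize 𝓕) ⟩
    m ^ K * m ^ cosize 𝓕       ∎

-- A recursive Boolean instead of a quantified inclusion: its indicator is then a product over the
-- two halves of `extend`, and the count of subfamilies factorises.
subfamily : SetSystem n → SetSystem n → Bool
subfamily {zero}  𝓒 𝓖 = if 𝓖 [] then 𝓒 [] else true
subfamily {suc n} 𝓒 𝓖 = subfamily (𝓒 ∘ (outside ∷_)) (𝓖 ∘ (outside ∷_))
                      ∧ subfamily (𝓒 ∘ (inside ∷_)) (𝓖 ∘ (inside ∷_))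

subfamily⇒⊆ : (𝓒 𝓖 : SetSystem n) → T (subfamily 𝓒 𝓖) → ∀ X → T (𝓖 X) → T (𝓒 X)
subfamily⇒⊆ 𝓒 𝓖 s []            𝓖X with 𝓖 []
... | true = s
subfamily⇒⊆ 𝓒 𝓖 s (outside ∷ X) 𝓖X with subfamily (𝓒 ∘ (outside ∷_)) (𝓖 ∘ (outside ∷_)) in eq
... | true = subfamily⇒⊆ (𝓒 ∘ (outside ∷_)) (𝓖 ∘ (outside ∷_)) (subst T (sym eq) _) X 𝓖X
subfamily⇒⊆ 𝓒 𝓖 s (inside ∷ X)  𝓖X with subfamily (𝓒 ∘ (outside ∷_)) (𝓖 ∘ (outside ∷_))
... | true = subfamily⇒⊆ (𝓒 ∘ (inside ∷_)) (𝓖 ∘ (inside ∷_)) s X 𝓖X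

length-filter-T : (b : A → Bool) → ∀ xs → length (filter (T? ∘ b) xs) ≡ sumᴸ (map (𝟙 ∘ b) xs)
length-filter-T b []       = refl
length-filter-T b (x ∷ xs) with b x
... | true  = cong suc (length-filter-T b xs)
... | false = length-filter-T b xs

numSubfamilies : (𝓒 : SetSystem n) →
  length (filter (T? ∘ subfamily 𝓒) (setSystems n)) ≡ 2 ^ size 𝓒
numSubfamilies 𝓒 = trans (length-filter-T (subfamily 𝓒) (setSystems _)) (go 𝓒)
  where
  𝟙-∧ : ∀ a b → 𝟙 (a ∧ b) ≡ 𝟙 a * 𝟙 b
  𝟙-∧ true  b = sym (+-identityʳ (𝟙 b))
  𝟙-∧ false b = refl
  go : ∀ {n} (𝓒 : SetSystem n) → sumᴸ (map (𝟙 ∘ subfamily 𝓒) (setSystems n)) ≡ 2 ^ size 𝓒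
  go {zero} 𝓒 with 𝓒 []
  ... | true  = refl
  ... | false = refl
  go {suc n} 𝓒 = trans
    (sum-cartesianProductWith extend _ (𝟙 ∘ subfamily 𝓒₀) (𝟙 ∘ subfamily 𝓒₁)
      (λ 𝓕 𝓖 → 𝟙-∧ (subfamily 𝓒₀ 𝓕) (subfamily 𝓒₁ 𝓖)) (setSystems n) (setSystems n))
    (trans (cong₂ _*_ (go 𝓒₀) (go 𝓒₁)) (sym (^-distribˡ-+-* 2 (size 𝓒₀) (size 𝓒₁))))
    where
    𝓒₀ = 𝓒 ∘ (outside ∷_)
    𝓒₁ = 𝓒 ∘ (inside ∷_)

-- Subsets under insertion, removal and exchange

lookup-ext : {X Y : Subset n} → (∀ i → lookup X i ≡ lookup Y i) → X ≡ Y
lookup-ext {X = X} {Y} eq =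
  trans (sym (tabulate∘lookup X)) (trans (tabulate-cong eq) (tabulate∘lookup Y))

∈⇒lookup : {X : Subset n} {i : Fin n} → i ∈ X → lookup X i ≡ inside
∈⇒lookup = []=⇒lookup

lookup⇒∈ : {X : Subset n} {i : Fin n} → lookup X i ≡ inside → i ∈ X
lookup⇒∈ {X = X} {i} = lookup⇒[]= i X

∉⇒lookup : {X : Subset n} {i : Fin n} → i ∉ X → lookup X i ≡ outside
∉⇒lookup i∉X = Bool.¬-not (i∉X ∘ lookup⇒∈)

lookup⇒∉ : {X : Subset n} {i : Fin n} → lookup X i ≡ outside → i ∉ X
lookup⇒∉ eq i∈X with trans (sym eq) (∈⇒lookup i∈X)
... | ()

∪⁅⁆≡update : (X : Subset n) (e : Fin n) → X ∪ ⁅ e ⁆ ≡ X [ e ]≔ inside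
∪⁅⁆≡update (s ∷ X) zero    = cong₂ _∷_ (Bool.∨-zeroʳ s) (∪-identityʳ X)
∪⁅⁆≡update (s ∷ X) (suc e) = cong₂ _∷_ (Bool.∨-identityʳ s) (∪⁅⁆≡update X e)

-- Two choices of c matter: the constant 1 gives the cardinality, and `toℕ` gives the sum that
-- defines the Graham-Sloane classes.
weight : (Fin n → ℕ) → Subset n → ℕ
weight c X = sum λ i → 𝟙 (lookup X i) * c i

weight-update : (c : Fin n → ℕ) (X : Subset n) (i : Fin n) (b : Bool) →
  weight c (X [ i ]≔ b) + 𝟙 (lookup X i) * c i ≡ weight c X + 𝟙 b * c i
weight-update c (s ∷ X) zero    b = swap (𝟙 b * c zero) (weight (c ∘ suc) X) (𝟙 s * c zero)
  where
  swap : ∀ x y z → x + y + z ≡ z + y + x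
  swap = solve-∀
weight-update c (s ∷ X) (suc i) b =
  trans (+-assoc (𝟙 s * c zero) _ _)
  (trans (cong (𝟙 s * c zero +_) (weight-update (c ∘ suc) X i b))
         (sym (+-assoc (𝟙 s * c zero) _ _)))

∣∣≡weight : (X : Subset n) → ∣ X ∣ ≡ weight (λ _ → 1) X
∣∣≡weight X = trans (sym (∑-∈ X)) (sum-cong-≗ λ i → sym (*-identityʳ (𝟙 (lookup X i))))

∣update∣ : (X : Subset n) (i : Fin n) (b : Bool) →
  ∣ X [ i ]≔ b ∣ + 𝟙 (lookup X i) ≡ ∣ X ∣ + 𝟙 b
∣update∣ X i b
  rewrite ∣∣≡weight X | ∣∣≡weight (X [ i ]≔ b)
        | sym (*-identityʳ (𝟙 (lookup X i))) | sym (*-identityʳ (𝟙 b)) =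
  weight-update (λ _ → 1) X i b

∣insert∣ : (X : Subset n) {i : Fin n} → lookup X i ≡ outside → ∣ X [ i ]≔ inside ∣ ≡ suc ∣ X ∣
∣insert∣ X {i} Xᵢ with ∣update∣ X i inside
... | eq rewrite Xᵢ = trans (sym (+-identityʳ _)) (trans eq (+-comm ∣ X ∣ 1))

∣remove∣ : (X : Subset n) {i : Fin n} → lookup X i ≡ inside → suc ∣ X [ i ]≔ outside ∣ ≡ ∣ X ∣
∣remove∣ X {i} Xᵢ with ∣update∣ X i outside
... | eq rewrite Xᵢ = trans (+-comm 1 _) (trans eq (+-identityʳ ∣ X ∣))

module _ (X : Subset n) {x b : Fin n} (X∋x : lookup X x ≡ inside) (X∌b : lookup X b ≡ outside) where

  x≢b : x ≢ b
  x≢b refl with trans (sym X∋x) X∌b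
  ... | ()

  lookup-remove-b : lookup (X [ x ]≔ outside) b ≡ outside
  lookup-remove-b = trans (lookup∘update′ (x≢b ∘ sym) X outside) X∌b

  ∣exchange∣ : ∣ exchange X x b ∣ ≡ ∣ X ∣
  ∣exchange∣ = trans (∣insert∣ (X [ x ]≔ outside) lookup-remove-b) (∣remove∣ X X∋x)

  weight-exchange : ∀ c → weight c (exchange X x b) + c x ≡ weight c X + c b
  weight-exchange c with weight-update c X x outside | weight-update c (X [ x ]≔ outside) b inside
  ... | eq₁ | eq₂ rewrite X∋x | lookup-remove-b =
    combine (weight c X) (weight c (X [ x ]≔ outside)) (weight c (exchange X x b)) (c x) (c b) eq₁ eq₂
    where
    combine : ∀ u v w p q → v + (p + 0) ≡ u + 0 → w + 0 ≡ v + (q + 0) → w + p ≡ u + q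
    combine u v w p q e₁ e₂
      rewrite +-identityʳ w | +-identityʳ p | +-identityʳ u | +-identityʳ q =
      trans (cong (_+ p) e₂) (trans (rot v q p) (cong (_+ q) e₁))
      where
      rot : ∀ v q p → v + q + p ≡ v + p + q
      rot = solve-∀

lookup-exchange-in : (X : Subset n) (x b : Fin n) → lookup (exchange X x b) b ≡ inside
lookup-exchange-in X x b = lookup∘update b (X [ x ]≔ outside) inside

lookup-exchange-out : (X : Subset n) {x b : Fin n} → x ≢ b → lookup (exchange X x b) x ≡ outside
lookup-exchange-out X {x} x≢b =
  trans (lookup∘update′ x≢b (X [ x ]≔ outside) inside) (lookup∘update x X outside)

lookup-exchange-other : (X : Subset n) {x b i : Fin n} → i ≢ x → i ≢ b →
                        lookup (exchange X x b) i ≡ lookup X i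
lookup-exchange-other X {x} i≢x i≢b =
  trans (lookup∘update′ i≢b (X [ x ]≔ outside) inside) (lookup∘update′ i≢x X outside)

-- Two different neighbours of X that lose the same element x are one exchange apart, so a stable
-- family contains at most one of them.
exchange-exchange-in : (X : Subset n) {x b c : Fin n} → x ≢ b → lookup X b ≡ outside →
                       exchange (exchange X x b) b c ≡ exchange X x c
exchange-exchange-in X {x} {b} {c} x≢b X∌b = lookup-ext λ i → helper i
  where
  helper : ∀ i → lookup (exchange (exchange X x b) b c) i ≡ lookup (exchange X x c) i
  helper i with i ≟ c | i ≟ b | i ≟ x
  ... | yes refl | _ | _ = trans (lookup-exchange-in (exchange X x b) b i) (sym (lookup-exchange-in X x i))
  ... | no i≢c | yes refl | _ = trans (lookup-exchange-out (exchange X x i) i≢c)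
                                  (sym (trans (lookup-exchange-other X (x≢b ∘ sym) i≢c) X∌b))
  ... | no i≢c | no i≢b | yes refl = trans (lookup-exchange-other (exchange X i b) i≢b i≢c)
                                       (trans (lookup-exchange-out X x≢b) (sym (lookup-exchange-out X i≢c)))
  ... | no i≢c | no i≢b | no i≢x = trans (lookup-exchange-other (exchange X x b) i≢b i≢c)
                                     (trans (lookup-exchange-other X i≢x i≢b)
                                            (sym (lookup-exchange-other X i≢x i≢c)))

-- The counterpart for neighbours of X that gain the same element b.
exchange-exchange-out : (X : Subset n) {x y b : Fin n} → x ≢ y → x ≢ b → y ≢ b → lookup X x ≡ inside →
                        exchange (exchange X x b) y x ≡ exchange X y b
exchange-exchange-out X {x} {y} {b} x≢y x≢b y≢b X∋x = lookup-ext λ i → helper i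
  where
  helper : ∀ i → lookup (exchange (exchange X x b) y x) i ≡ lookup (exchange X y b) i
  helper i with i ≟ x | i ≟ y | i ≟ b
  ... | yes refl | _ | _ = trans (lookup-exchange-in (exchange X i b) y i)
                             (sym (trans (lookup-exchange-other X x≢y x≢b) X∋x))
  ... | no i≢x | yes refl | _ = trans (lookup-exchange-out (exchange X x b) i≢x)
                                  (sym (lookup-exchange-out X y≢b))
  ... | no i≢x | no i≢y | yes refl = trans (lookup-exchange-other (exchange X x i) i≢y i≢x)
                                       (trans (lookup-exchange-in X x i) (sym (lookup-exchange-in X y i)))
  ... | no i≢x | no i≢y | no i≢b = trans (lookup-exchange-other (exchange X x b) i≢y i≢x)
                                     (trans (lookup-exchange-other X i≢x i≢b)
                                            (sym (lookup-exchange-other X i≢y i≢b)))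

update-⊆ : {X Y : Subset n} {e : Fin n} → X ⊆ Y → e ∈ Y → X [ e ]≔ inside ⊆ Y
update-⊆ {X = X} {e = e} X⊆Y e∈Y {i} i∈ with i ≟ e
... | yes refl = e∈Y
... | no i≢e   = X⊆Y (lookup⇒∈ (trans (sym (lookup∘update′ i≢e X inside)) (∈⇒lookup i∈)))

⊆-update : (X : Subset n) (e : Fin n) → X ⊆ X [ e ]≔ inside
⊆-update X e {i} i∈X with i ≟ e
... | yes refl = lookup⇒∈ (lookup∘update i X inside)
... | no i≢e   = lookup⇒∈ (trans (lookup∘update′ i≢e X inside) (∈⇒lookup i∈X))

remove-⊂ : (X : Subset n) {e : Fin n} → lookup X e ≡ inside → X [ e ]≔ outside ⊂ X
remove-⊂ X {e} X∋e = ⊆X , e , lookup⇒∈ X∋e , lookup⇒∉ (lookup∘update e X outside)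
  where
  ⊆X : X [ e ]≔ outside ⊆ X
  ⊆X {i} i∈ with i ≟ e
  ... | yes refl = contradiction i∈ (lookup⇒∉ (lookup∘update i X outside))
  ... | no i≢e   = lookup⇒∈ (trans (sym (lookup∘update′ i≢e X outside)) (∈⇒lookup i∈))

⊆∧∣∣≥⇒≡ : {X Y : Subset n} → X ⊆ Y → ∣ Y ∣ ≤ ∣ X ∣ → X ≡ Y
⊆∧∣∣≥⇒≡ {X = X} X⊆Y ∣Y∣≤∣X∣ = ⊆-antisym X⊆Y λ {y} y∈Y →
  decidable-stable (y ∈? X) λ y∉X → <⇒≱ (p⊂q⇒∣p∣<∣q∣ (X⊆Y , y , y∈Y , y∉X)) ∣Y∣≤∣X∣

∃∈∖ : (X Y : Subset n) → ∣ X ∣ < ∣ Y ∣ → ∃[ e ] (e ∈ Y × e ∉ X)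
∃∈∖ X Y ∣X∣<∣Y∣ with any? (λ e → (e ∈? Y) ×-dec ¬? (e ∈? X))
... | yes e = e
... | no ∄e = contradiction (p⊆q⇒∣p∣≤∣q∣ λ {y} y∈Y →
                decidable-stable (y ∈? X) λ y∉X → ∄e (y , y∈Y , y∉X)) (<⇒≱ ∣X∣<∣Y∣)

∃-lookup-inside : (X : Subset n) → 0 < ∣ X ∣ → ∃[ x ] (lookup X x ≡ inside)
∃-lookup-inside {n} X 0<∣X∣ with ∃∈∖ ⊥ X (subst (_< ∣ X ∣) (sym (∣⊥∣≡0 n)) 0<∣X∣)
... | x , x∈X , _ = x , ∈⇒lookup x∈X

∃-lookup-outside : (X : Subset n) → ∣ X ∣ < n → ∃[ x ] (lookup X x ≡ outside)
∃-lookup-outside {n} X ∣X∣<n with ∃∈∖ X ⊤ (subst (∣ X ∣ <_) (sym (∣⊤∣≡n n)) ∣X∣<n)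
... | x , _ , x∉X = x , ∉⇒lookup x∉X

∃-size : ∀ n r → r ≤ n → ∃[ X ] (∣_∣ {n} X ≡ r)
∃-size n       zero    _         = ⊥ , ∣⊥∣≡0 n
∃-size (suc n) (suc r) (s≤s r≤n) with ∃-size n r r≤n
... | X , eq = inside ∷ X , cong suc eq

-- Rank, and sparse paving matroids as stable families

∈-subsets : (X : Subset n) → X ∈ᴸ subsets n
∈-subsets []      = here refl
∈-subsets (s ∷ X) = ∈-cartesianProductWith⁺ _∷_ (side∈ s) (∈-subsets X)
  where
  side∈ : ∀ s → s ∈ᴸ (outside ∷ inside ∷ [])
  side∈ outside = here refl
  side∈ inside  = there (here refl)

∣I∣≤rank : (M : SetSystem n) (X I : Subset n) → I ⊆ X → Indep M I → ∣ I ∣ ≤ rank M X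
∣I∣≤rank M X I I⊆X MI = v≤max⁺ 0 _ (inj₂ (lose
  (∈-map⁺ ∣_∣ (∈-filter⁺ (λ Y → (Y ⊆? X) ×-dec T? (M Y)) (∈-subsets I) (I⊆X , MI))) ≤-refl))

rank≤ : (M : SetSystem n) (X : Subset n) (k : ℕ) →
        (∀ I → I ⊆ X → Indep M I → ∣ I ∣ ≤ k) → rank M X ≤ k
rank≤ {n} M X k bound = max≤v⁺ z≤n (All.map⁺ (All.map (λ {I} (I⊆X , MI) → bound I I⊆X MI)
  (All.all-filter (λ Y → (Y ⊆? X) ×-dec T? (M Y)) (subsets n))))

-- A stable family of r-sets is a stable set of vertices of the Johnson graph J(n, r).
record Stable (r : ℕ) (𝓕 : SetSystem n) : Set where
  field
    layer    : ∀ X → T (𝓕 X) → ∣ X ∣ ≡ r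
    no-edge  : ∀ X x b → lookup X x ≡ inside → lookup X b ≡ outside →
               T (𝓕 X) → ¬ T (𝓕 (exchange X x b))

-- Independence in `M` means size at most r and absence from 𝓕. Stating this by implications lets it
-- pass to any system pointwise equal to a given one, as the counting up to `≗` requires.
record Avoids (r : ℕ) (𝓕 M : SetSystem n) : Set where
  field
    size≤  : ∀ X → Indep M X → ∣ X ∣ ≤ r
    avoids : ∀ X → Indep M X → ¬ T (𝓕 X)
    indep  : ∀ X → ∣ X ∣ ≤ r → ¬ T (𝓕 X) → Indep M X

module _ {r} {𝓕 M : SetSystem n} (stable : Stable r 𝓕) (av : Avoids r 𝓕 M)
         (0<r : 0 < r) (r<n : r < n) where

  open Stable stable
  open Avoids av

  -- Augmentation is where stability enters. If no element of Y outside X can be added, every such X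
  -- + y lies in 𝓕. Two of these would be adjacent, so Y has just one element e outside X. Then Y =
  -- X + e by size, and Y would be a member of 𝓕.
  avoids⇒isMatroid : IsMatroid M
  avoids⇒isMatroid = record
    { empty        = indep ⊥ (≤-trans (≤-reflexive (∣⊥∣≡0 n)) z≤n)
                       λ F → <⇒≢ 0<r (trans (sym (∣⊥∣≡0 n)) (layer ⊥ F))
    ; hereditary   = hereditary
    ; augmentation = augmentation
    }
    where
    hereditary : ∀ X Y → X ⊆ Y → Indep M Y → Indep M X
    hereditary X Y X⊆Y MY = indep X (≤-trans (p⊆q⇒∣p∣≤∣q∣ X⊆Y) (size≤ Y MY)) λ FX →
      avoids Y MY (subst (T ∘ 𝓕) (⊆∧∣∣≥⇒≡ X⊆Y
        (≤-trans (size≤ Y MY) (≤-reflexive (sym (layer X FX))))) FX)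

    augmentation : ∀ X Y → Indep M X → Indep M Y → ∣ X ∣ < ∣ Y ∣ →
                   ∃[ e ] (e ∈ Y × e ∉ X × Indep M (X ∪ ⁅ e ⁆))
    augmentation X Y MX MY ∣X∣<∣Y∣
      with any? (λ e → (e ∈? Y) ×-dec ¬? (e ∈? X) ×-dec T? (M (X ∪ ⁅ e ⁆)))
    ... | yes found = found
    ... | no ∄e with ∃∈∖ X Y ∣X∣<∣Y∣
    ...   | e , e∈Y , e∉X = contradiction (subst (T ∘ 𝓕) Xe≡Y (dep e e∈Y e∉X)) (avoids Y MY)
      where
      ∣X+∣ : ∀ y → y ∉ X → ∣ X [ y ]≔ inside ∣ ≡ suc ∣ X ∣
      ∣X+∣ y y∉X = ∣insert∣ X (∉⇒lookup y∉X)
      dep : ∀ y → y ∈ Y → y ∉ X → T (𝓕 (X [ y ]≔ inside))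
      dep y y∈Y y∉X = decidable-stable (T? _) λ ¬F → ∄e (y , y∈Y , y∉X ,
        subst (Indep M) (sym (∪⁅⁆≡update X y))
          (indep _ (≤-trans (≤-reflexive (∣X+∣ y y∉X)) (≤-trans ∣X∣<∣Y∣ (size≤ Y MY))) ¬F))
      exchange-e : ∀ y → e ≢ y → exchange (X [ e ]≔ inside) e y ≡ X [ y ]≔ inside
      exchange-e y e≢y = lookup-ext helper
        where
        helper : ∀ i → lookup (exchange (X [ e ]≔ inside) e y) i ≡ lookup (X [ y ]≔ inside) i
        helper i with i ≟ y | i ≟ e
        ... | yes refl | _ = trans (lookup-exchange-in (X [ e ]≔ inside) e i) (sym (lookup∘update i X inside))
        ... | no i≢y | yes refl = trans (lookup-exchange-out (X [ i ]≔ inside) i≢y)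
              (sym (trans (lookup∘update′ i≢y X inside) (∉⇒lookup e∉X)))
        ... | no i≢y | no i≢e = trans (lookup-exchange-other (X [ e ]≔ inside) i≢e i≢y)
              (trans (lookup∘update′ i≢e X inside) (sym (lookup∘update′ i≢y X inside)))
      Y⊆Xe : Y ⊆ X [ e ]≔ inside
      Y⊆Xe {y} y∈Y with y ∈? X | e ≟ y
      ... | yes y∈X | _        = ⊆-update X e y∈X
      ... | no _    | yes refl = lookup⇒∈ (lookup∘update e X inside)
      ... | no y∉X  | no e≢y   = contradiction
        (subst (T ∘ 𝓕) (sym (exchange-e y e≢y)) (dep y y∈Y y∉X))
        (no-edge (X [ e ]≔ inside) e y (lookup∘update e X inside)
          (trans (lookup∘update′ (e≢y ∘ sym) X inside) (∉⇒lookup y∉X)) (dep e e∈Y e∉X))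
      Xe≡Y : X [ e ]≔ inside ≡ Y
      Xe≡Y = sym (⊆∧∣∣≥⇒≡ Y⊆Xe (≤-trans (≤-reflexive (∣X+∣ e e∉X)) ∣X∣<∣Y∣))

  rank≤r : ∀ X → rank M X ≤ r
  rank≤r X = rank≤ M X r λ I _ MI → size≤ I MI

  -- If the r-set at hand belongs to 𝓕, any exchange of it does not; 0 < r < n guarantees that an
  -- exchange exists.
  rank⊤≡r : rank M ⊤ ≡ r
  rank⊤≡r = ≤-antisym (rank≤r ⊤) r≤rank
    where
    r≤rank : r ≤ rank M ⊤
    r≤rank with ∃-size n r (<⇒≤ r<n)
    ... | A , ∣A∣≡r with T? (𝓕 A)
    ...   | no ¬FA = ≤-trans (≤-reflexive (sym ∣A∣≡r))
                       (∣I∣≤rank M ⊤ A ⊆⊤ (indep A (≤-reflexive ∣A∣≡r) ¬FA))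
    ...   | yes FA with ∃-lookup-inside A (subst (0 <_) (sym ∣A∣≡r) 0<r)
                      | ∃-lookup-outside A (subst (_< n) (sym ∣A∣≡r) r<n)
    ...     | x , A∋x | b , A∌b = ≤-trans (≤-reflexive (sym ∣A′∣≡r))
                (∣I∣≤rank M ⊤ _ ⊆⊤ (indep _ (≤-reflexive ∣A′∣≡r) (no-edge A x b A∋x A∌b FA)))
      where
      ∣A′∣≡r : ∣ exchange A x b ∣ ≡ r
      ∣A′∣≡r = trans (∣exchange∣ A A∋x A∌b) ∣A∣≡r

  -- A circuit D with more than r elements contains the independent set D - c of size at least r, so
  -- it spans. A nonspanning circuit is therefore a member of 𝓕 and has rank r - 1. For e outside D,
  -- the exchange of c for e leaves 𝓕, so D + e has rank r.
  avoids⇒isSparsePaving : IsSparsePaving M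
  avoids⇒isSparsePaving = avoids⇒isMatroid , circuit⇒hyperplane
    where
    circuit⇒hyperplane : ∀ D → Circuit M D → ¬ Spanning M D → Hyperplane M D
    circuit⇒hyperplane D (¬MD , M⊂D) ¬spanning = flat , trans 1+rank≡r (sym rank⊤≡r)
      where
      0<∣D∣ : 0 < ∣ D ∣
      0<∣D∣ = n≢0⇒n>0 λ ∣D∣≡0 → ¬MD (indep D (≤-trans (≤-reflexive ∣D∣≡0) z≤n)
        λ FD → <⇒≢ 0<r (trans (sym ∣D∣≡0) (layer D FD)))
      c : Fin n
      c = proj₁ (∃-lookup-inside D 0<∣D∣)
      D∋c : lookup D c ≡ inside
      D∋c = proj₂ (∃-lookup-inside D 0<∣D∣)
      D-c : Subset n
      D-c = D [ c ]≔ outside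
      D-c≤rank : ∣ D-c ∣ ≤ rank M D
      D-c≤rank = ∣I∣≤rank M D D-c (proj₁ (remove-⊂ D D∋c)) (M⊂D D-c (remove-⊂ D D∋c))
      ∣D∣≤r : ∣ D ∣ ≤ r
      ∣D∣≤r = ≮⇒≥ λ r<∣D∣ → ¬spanning (trans
        (≤-antisym (rank≤r D) (≤-trans (s≤s⁻¹ (≤-trans r<∣D∣ (≤-reflexive (sym (∣remove∣ D D∋c))))) D-c≤rank))
        (sym rank⊤≡r))
      FD : T (𝓕 D)
      FD = decidable-stable (T? _) λ ¬FD → ¬MD (indep D ∣D∣≤r ¬FD)
      1+rank≡r : suc (rank M D) ≡ r
      1+rank≡r = trans (cong suc (≤-antisym rank≤∣D-c∣ D-c≤rank)) (trans (∣remove∣ D D∋c) (layer D FD))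
        where
        rank≤∣D-c∣ : rank M D ≤ ∣ D-c ∣
        rank≤∣D-c∣ = rank≤ M D _ λ I I⊆D MI → ≮⇒≥ λ lt → ¬MD (subst (Indep M)
          (⊆∧∣∣≥⇒≡ I⊆D (≤-trans (≤-reflexive (sym (∣remove∣ D D∋c))) lt)) MI)
      flat : Flat M D
      flat e e∉D = ≤-trans (≤-reflexive 1+rank≡r) (≤-trans (≤-reflexive (sym ∣D′∣≡r))
        (∣I∣≤rank M _ _ D′⊆ (indep _ (≤-reflexive ∣D′∣≡r) (no-edge D c e D∋c (∉⇒lookup e∉D) FD))))
        where
        ∣D′∣≡r : ∣ exchange D c e ∣ ≡ r
        ∣D′∣≡r = trans (∣exchange∣ D D∋c (∉⇒lookup e∉D)) (layer D FD)
        D′⊆ : exchange D c e ⊆ D ∪ ⁅ e ⁆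
        D′⊆ = update-⊆ (⊆-trans (proj₁ (remove-⊂ D D∋c)) (p⊆p∪q ⁅ e ⁆)) (q⊆p∪q D ⁅ e ⁆ (x∈⁅x⁆ e))

nonbases : ℕ → SetSystem n → SetSystem n
nonbases r M X = (∣ X ∣ ≡ᵇ r) ∧ not (M X)

nonbases⁻ : ∀ r (M : SetSystem n) X → T (nonbases r M X) → ∣ X ∣ ≡ r × ¬ Indep M X
nonbases⁻ r M X NX with Equivalence.to T-∧ NX
... | T∣X∣≡r , ¬MX = ≡ᵇ⇒≡ _ _ T∣X∣≡r , λ MX → subst (T ∘ not) (Equivalence.to T-≡ MX) ¬MX

nonbases⁺ : ∀ r (M : SetSystem n) X → ∣ X ∣ ≡ r → ¬ Indep M X → T (nonbases r M X)
nonbases⁺ r M X ∣X∣≡r ¬MX =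
  Equivalence.from T-∧ (≡⇒≡ᵇ _ _ ∣X∣≡r , Equivalence.from T-≡ (cong not (Bool.¬-not (¬MX ∘ Equivalence.from T-≡))))

module _ {n} {M : SetSystem n} (sp : IsSparsePaving M) where

  private r₀ = rank M ⊤

  open IsMatroid (proj₁ sp)

  indep⇒∣∣≤rank : ∀ X → Indep M X → ∣ X ∣ ≤ r₀
  indep⇒∣∣≤rank X MX = ∣I∣≤rank M ⊤ X ⊆⊤ MX

  dependent⇒rank<∣∣ : ∀ X → ¬ Indep M X → rank M X < ∣ X ∣
  dependent⇒rank<∣∣ X ¬MX = ≤∧≢⇒< (rank≤ M X ∣ X ∣ λ I I⊆X _ → p⊆q⇒∣p∣≤∣q∣ I⊆X) rank≢
    where
    rank≢ : rank M X ≢ ∣ X ∣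
    rank≢ eq with ∣ X ∣ in ∣X∣≡
    ... | zero  = ¬MX (hereditary X ⊥ (λ {x} x∈X → contradiction
                    (≤-trans (≤-trans (≤-reflexive (sym (∣⁅x⁆∣≡1 x)))
                      (p⊆q⇒∣p∣≤∣q∣ λ {y} y∈ → subst (_∈ X) (sym (x∈⁅y⁆⇒x≡y x y∈)) x∈X))
                      (≤-reflexive ∣X∣≡)) (<⇒≱ z<s)) empty)
    ... | suc k = <⇒≱ (≤-reflexive (sym eq)) (rank≤ M X k λ I I⊆X MI → s≤s⁻¹ (≤∧≢⇒<
                    (≤-trans (p⊆q⇒∣p∣≤∣q∣ I⊆X) (≤-reflexive ∣X∣≡)) λ ∣I∣≡ →
                      ¬MX (subst (Indep M) (⊆∧∣∣≥⇒≡ I⊆X (≤-reflexive (trans ∣X∣≡ (sym ∣I∣≡)))) MI)))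

  -- A smallest counterexample X is a circuit, and rank X < ∣X∣ < r₀ makes it nonspanning. As a
  -- hyperplane it would have rank r₀ - 1, which leaves no room for both inequalities.
  ∣∣<rank⇒indep : ∀ X → ∣ X ∣ < r₀ → Indep M X
  ∣∣<rank⇒indep X = <-rec (λ k → ∀ X → ∣ X ∣ ≡ k → k < r₀ → Indep M X) step ∣ X ∣ X refl
    where
    step : ∀ k → (∀ {l} → l < k → ∀ X → ∣ X ∣ ≡ l → l < r₀ → Indep M X) →
           ∀ X → ∣ X ∣ ≡ k → k < r₀ → Indep M X
    step k rec X refl k<r = decidable-stable (T? _) λ ¬MX →
      let rank<   = dependent⇒rank<∣∣ X ¬MX
          circuit = ¬MX , λ Y Y⊂X → rec (p⊂q⇒∣p∣<∣q∣ Y⊂X) Y refl (<-trans (p⊂q⇒∣p∣<∣q∣ Y⊂X) k<r)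
          hyper   = proj₂ sp X circuit (<⇒≢ (<-trans rank< k<r))
      in <⇒≱ k<r (≤-trans (≤-reflexive (sym (proj₂ hyper))) rank<)

  -- A dependent r₀-set X is a nonspanning circuit, hence a hyperplane, so adding b raises the rank.
  -- But Z = X - x is independent, and if Z + x and Z + b are both dependent, no independent subset
  -- of X + b can augment Z, so the rank stays at ∣Z∣.
  nonbases-stable : Stable r₀ (nonbases r₀ M)
  nonbases-stable = record
    { layer   = λ X NX → proj₁ (nonbases⁻ r₀ M X NX)
    ; no-edge = no-edge
    }
    where
    no-edge : ∀ X x b → lookup X x ≡ inside → lookup X b ≡ outside →
              T (nonbases r₀ M X) → ¬ T (nonbases r₀ M (exchange X x b))
    no-edge X x b X∋x X∌b NX NX′ = <⇒≱ (proj₁ hyper b (lookup⇒∉ X∌b))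
        (≤-trans (rank≤ M (X ∪ ⁅ b ⁆) ∣ Z ∣ small) ∣Z∣≤rank)
      where
      ∣X∣≡r : ∣ X ∣ ≡ r₀
      ∣X∣≡r = proj₁ (nonbases⁻ r₀ M X NX)
      ¬MX  = proj₂ (nonbases⁻ r₀ M X NX)
      ¬MX′ = proj₂ (nonbases⁻ r₀ M (exchange X x b) NX′)
      Z : Subset n
      Z = X [ x ]≔ outside
      1+∣Z∣≡r : suc ∣ Z ∣ ≡ r₀
      1+∣Z∣≡r = trans (∣remove∣ X X∋x) ∣X∣≡r
      MZ : Indep M Z
      MZ = ∣∣<rank⇒indep Z (≤-reflexive 1+∣Z∣≡r)
      hyper : Hyperplane M X
      hyper = proj₂ sp X
        (¬MX , λ Y Y⊂X → ∣∣<rank⇒indep Y (≤-trans (p⊂q⇒∣p∣<∣q∣ Y⊂X) (≤-reflexive ∣X∣≡r)))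
        (<⇒≢ (≤-trans (dependent⇒rank<∣∣ X ¬MX) (≤-reflexive ∣X∣≡r)))
      ∣Z∣≤rank : ∣ Z ∣ ≤ rank M X
      ∣Z∣≤rank = ∣I∣≤rank M X Z (proj₁ (remove-⊂ X X∋x)) MZ
      Z+x≡X : Z [ x ]≔ inside ≡ X
      Z+x≡X = lookup-ext helper
        where
        helper : ∀ i → lookup (Z [ x ]≔ inside) i ≡ lookup X i
        helper i with i ≟ x
        ... | yes refl = trans (lookup∘update i Z inside) (sym X∋x)
        ... | no i≢x   = trans (lookup∘update′ i≢x Z inside) (lookup∘update′ i≢x X outside)
      small : ∀ I → I ⊆ X ∪ ⁅ b ⁆ → Indep M I → ∣ I ∣ ≤ ∣ Z ∣
      small I I⊆ MI = ≮⇒≥ λ lt → absurd (augmentation Z I MZ MI lt)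
        where
        absurd : ¬ (∃[ e ] (e ∈ I × e ∉ Z × Indep M (Z ∪ ⁅ e ⁆)))
        absurd (e , e∈I , e∉Z , MZe) rewrite ∪⁅⁆≡update Z e with x∈p∪q⁻ X ⁅ b ⁆ (I⊆ e∈I) | e ≟ x
        ... | _        | yes refl = ¬MX (subst (Indep M) Z+x≡X MZe)
        ... | inj₁ e∈X | no e≢x   = e∉Z (lookup⇒∈ (trans (lookup∘update′ e≢x X outside) (∈⇒lookup e∈X)))
        ... | inj₂ e∈b | no _ rewrite x∈⁅y⁆⇒x≡y b e∈b = ¬MX′ MZe

-- Minors along an injection

insertAt-⊆ : {X Y : Subset n} (e : Fin (suc n)) (s : Bool) → X ⊆ Y → insertAt X e s ⊆ insertAt Y e s
insertAt-⊆ {X = X} {Y} e s X⊆Y {i} i∈ with e ≟ i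
... | yes refl = lookup⇒∈ (trans (insertAt-lookup Y e s) (trans (sym (insertAt-lookup X e s)) (∈⇒lookup i∈)))
... | no e≢i   = subst (_∈ insertAt Y e s) (punchIn-punchOut e≢i)
  (lookup⇒∈ (trans (insertAt-punchIn Y e s _) (∈⇒lookup (X⊆Y (lookup⇒∈
    (trans (sym (insertAt-punchIn X e s _)) (trans (cong (lookup (insertAt X e s)) (punchIn-punchOut e≢i)) (∈⇒lookup i∈))))))))

Hereditary : SetSystem n → Set
Hereditary M = ∀ X Y → X ⊆ Y → Indep M Y → Indep M X

insertAt-removeAt-lookup : (Z : Subset (suc n)) (e : Fin (suc n)) {s : Bool} → lookup Z e ≡ s →
                           insertAt (removeAt Z e) e s ≡ Z
insertAt-removeAt-lookup Z e refl = insertAt-removeAt Z e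

-- Z copies Y on the image of ι and S elsewhere. As a relation, this survives the removal of an
-- element off the image.
record Extends (ι : Fin k → Fin n) (S : Subset n) (Y : Subset k) (Z : Subset n) : Set where
  field
    on-image  : ∀ j → lookup Z (ι j) ≡ lookup Y j
    off-image : ∀ e → (∀ j → ι j ≢ e) → lookup Z e ≡ lookup S e

-- Off the image, elements of S are contracted and all others deleted, one per recursive call. Once
-- ι is onto, its inverse is the required relabelling.
minor-along : ∀ {k n} (M : SetSystem n) → Hereditary M → (ι : Fin k → Fin n) → Injective _≡_ _≡_ ι →
  (S : Subset n) → Indep M S →
  ∃[ l ] ∃[ M′ ] M′ ≼ M × ∃[ π ] (∀ Y Z → Extends ι S Y Z → M′ (preimage {l} {k} π Y) ≡ M Z)
minor-along {k} {n} M her ι ι-inj S MS with any? (λ e → all? (λ j → ¬? (ι j ≟ e)))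
... | no onto = n , M , ≼-refl , permutation to ι (ι-inj ∘ ι-to ∘ ι) ι-to ,
    λ Y Z ext → cong M (lookup-ext λ e → trans (lookup∘tabulate (lookup Y ∘ to) e)
      (trans (sym (Extends.on-image ext (to e))) (cong (lookup Z) (ι-to e))))
  where
  hit : ∀ e → ∃[ j ] (ι j ≡ e)
  hit e = decidable-stable (any? (λ j → ι j ≟ e)) λ ∄j → onto (e , λ j ιj≡e → ∄j (j , ιj≡e))
  to : Fin n → Fin k
  to = proj₁ ∘ hit
  ι-to : ∀ e → ι (to e) ≡ e
  ι-to = proj₂ ∘ hit
minor-along {k} {suc n} M her ι ι-inj S MS | yes (e , e∉ι) = lemma (lookup S e) refl
  where
  ι′ : Fin k → Fin n
  ι′ j = punchOut {i = e} (e∉ι j ∘ sym)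
  ι′-inj : Injective _≡_ _≡_ ι′
  ι′-inj {i} {j} eq = ι-inj (punchOut-injective (e∉ι i ∘ sym) (e∉ι j ∘ sym) eq)
  lookup-punchIn : ∀ (Z : Subset (suc n)) i → lookup (removeAt Z e) i ≡ lookup Z (punchIn e i)
  lookup-punchIn Z i = trans (cong (lookup (removeAt Z e)) (sym (punchOut-punchIn e)))
                             (removeAt-punchOut Z (punchInᵢ≢i e i ∘ sym))
  extends′ : ∀ Y Z → Extends ι S Y Z → Extends ι′ (removeAt S e) Y (removeAt Z e)
  extends′ Y Z ext = record
    { on-image  = λ j → trans (removeAt-punchOut Z (e∉ι j ∘ sym)) (on-image j)
    ; off-image = λ i i∉ι′ → trans (lookup-punchIn Z i)
        (trans (off-image (punchIn e i) λ j ιj≡ → i∉ι′ j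
          (trans (punchOut-cong e ιj≡) (punchOut-punchIn e)))
        (sym (lookup-punchIn S i)))
    }
    where
    open Extends ext
  -- An element of the independent set S is not a loop, so the conditional in the contraction takes
  -- its first branch.
  contracted : lookup S e ≡ inside → ∀ X → (M // e) X ≡ M (insertAt X e inside)
  contracted S∋e X = cong (λ b → if b then M (insertAt X e inside) else M (insertAt X e outside))
    (Equivalence.to T-≡ (her ⁅ e ⁆ S (λ i∈ → subst (_∈ S) (sym (x∈⁅y⁆⇒x≡y e i∈)) (lookup⇒∈ S∋e)) MS))
  lemma : ∀ s → lookup S e ≡ s →
    ∃[ l ] ∃[ M′ ] M′ ≼ M × ∃[ π ] (∀ Y Z → Extends ι S Y Z → M′ (preimage {l} {k} π Y) ≡ M Z)
  lemma outside S∌e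
    with minor-along (M \\ e) (λ X Y X⊆Y → her _ _ (insertAt-⊆ e outside X⊆Y)) ι′ ι′-inj (removeAt S e)
           (subst (Indep M) (sym (insertAt-removeAt-lookup S e S∌e)) MS)
  ... | l , M′ , M′≼ , π , eq = l , M′ , delete e M′≼ , π , λ Y Z ext →
    trans (eq Y (removeAt Z e) (extends′ Y Z ext))
          (cong M (insertAt-removeAt-lookup Z e (trans (Extends.off-image ext e e∉ι) S∌e)))
  lemma inside S∋e
    with minor-along (M // e) (λ X Y X⊆Y → subst T (sym (contracted S∋e X)) ∘ her _ _ (insertAt-⊆ e inside X⊆Y) ∘ subst T (contracted S∋e Y))
           ι′ ι′-inj (removeAt S e)
           (subst T (sym (trans (contracted S∋e (removeAt S e)) (cong M (insertAt-removeAt-lookup S e S∋e)))) MS)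
  ... | l , M′ , M′≼ , π , eq = l , M′ , contract e M′≼ , π , λ Y Z ext →
    trans (eq Y (removeAt Z e) (extends′ Y Z ext))
      (trans (contracted S∋e (removeAt Z e))
        (cong M (insertAt-removeAt-lookup Z e (trans (Extends.off-image ext e e∉ι) S∋e))))

place : (Fin k → Fin n) → Subset n → Subset k → Subset n
place ι S []      = S
place ι S (y ∷ Y) = place (ι ∘ suc) S Y [ ι zero ]≔ y

lookup-place-off : (ι : Fin k → Fin n) (S : Subset n) (Y : Subset k) →
                   ∀ e → (∀ j → ι j ≢ e) → lookup (place ι S Y) e ≡ lookup S e
lookup-place-off ι S []      e e∉ι = refl
lookup-place-off ι S (y ∷ Y) e e∉ι =
  trans (lookup∘update′ (e∉ι zero ∘ sym) (place (ι ∘ suc) S Y) y)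
        (lookup-place-off (ι ∘ suc) S Y e (e∉ι ∘ suc))

lookup-place-on : (ι : Fin k → Fin n) → Injective _≡_ _≡_ ι → (S : Subset n) (Y : Subset k) →
                  ∀ j → lookup (place ι S Y) (ι j) ≡ lookup Y j
lookup-place-on ι ι-inj S (y ∷ Y) zero    = lookup∘update (ι zero) (place (ι ∘ suc) S Y) y
lookup-place-on ι ι-inj S (y ∷ Y) (suc j) =
  trans (lookup∘update′ (λ eq → 0≢1+ (ι-inj eq)) (place (ι ∘ suc) S Y) y)
        (lookup-place-on (ι ∘ suc) (suc-injective ∘ ι-inj) S Y j)
  where
  0≢1+ : suc j ≢ zero
  0≢1+ ()

∣place∣ : (ι : Fin k → Fin n) → Injective _≡_ _≡_ ι → (S : Subset n) (Y : Subset k) →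
          ∣ place ι S Y ∣ + sum (λ j → 𝟙 (lookup S (ι j))) ≡ ∣ S ∣ + ∣ Y ∣
∣place∣ ι ι-inj S []      = refl
∣place∣ ι ι-inj S (y ∷ Y) = begin
  ∣ Z [ ι zero ]≔ y ∣ + (𝟙 (lookup S (ι zero)) + rest)
    ≡⟨ +-assoc ∣ Z [ ι zero ]≔ y ∣ (𝟙 (lookup S (ι zero))) rest ⟨
  ∣ Z [ ι zero ]≔ y ∣ + 𝟙 (lookup S (ι zero)) + rest
    ≡⟨ cong (λ b → ∣ Z [ ι zero ]≔ y ∣ + 𝟙 b + rest)
            (lookup-place-off (ι ∘ suc) S Y (ι zero) (λ j eq → 1+≢0 (ι-inj eq))) ⟨
  ∣ Z [ ι zero ]≔ y ∣ + 𝟙 (lookup Z (ι zero)) + rest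
    ≡⟨ cong (_+ rest) (∣update∣ Z (ι zero) y) ⟩
  ∣ Z ∣ + 𝟙 y + rest
    ≡⟨ trans (+-assoc ∣ Z ∣ (𝟙 y) rest) (trans (cong (∣ Z ∣ +_) (+-comm (𝟙 y) rest)) (sym (+-assoc ∣ Z ∣ rest (𝟙 y)))) ⟩
  ∣ Z ∣ + rest + 𝟙 y
    ≡⟨ cong (_+ 𝟙 y) (∣place∣ (ι ∘ suc) (suc-injective ∘ ι-inj) S Y) ⟩
  ∣ S ∣ + ∣ Y ∣ + 𝟙 y
    ≡⟨ +-assoc ∣ S ∣ ∣ Y ∣ (𝟙 y) ⟩
  ∣ S ∣ + (∣ Y ∣ + 𝟙 y)
    ≡⟨ cong (∣ S ∣ +_) (∣∷∣ y) ⟩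
  ∣ S ∣ + ∣ y ∷ Y ∣ ∎
  where
  open ≡-Reasoning
  Z = place (ι ∘ suc) S Y
  rest = sum (λ j → 𝟙 (lookup S (ι (suc j))))
  1+≢0 : ∀ {j} → Fin.suc j ≢ zero
  1+≢0 ()
  ∣∷∣ : ∀ y → ∣ Y ∣ + 𝟙 y ≡ ∣ y ∷ Y ∣
  ∣∷∣ true  = +-comm ∣ Y ∣ 1
  ∣∷∣ false = +-identityʳ ∣ Y ∣

place-update : (ι : Fin k → Fin n) → Injective _≡_ _≡_ ι → (S : Subset n) (Y : Subset k) →
               ∀ i b → place ι S (Y [ i ]≔ b) ≡ place ι S Y [ ι i ]≔ b
place-update ι ι-inj S Y i b = lookup-ext helper
  where
  helper : ∀ e → lookup (place ι S (Y [ i ]≔ b)) e ≡ lookup (place ι S Y [ ι i ]≔ b) e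
  helper e with any? (λ j → ι j ≟ e)
  ... | no e∉ι = trans (lookup-place-off ι S (Y [ i ]≔ b) e (λ j eq → e∉ι (j , eq)))
                   (sym (trans (lookup∘update′ (λ eq → e∉ι (i , sym eq)) (place ι S Y) b)
                               (lookup-place-off ι S Y e (λ j eq → e∉ι (j , eq)))))
  ... | yes (j , refl) with j ≟ i
  ...   | yes refl = trans (lookup-place-on ι ι-inj S (Y [ j ]≔ b) j)
                       (trans (lookup∘update j Y b) (sym (lookup∘update (ι j) (place ι S Y) b)))
  ...   | no j≢i   = trans (lookup-place-on ι ι-inj S (Y [ i ]≔ b) j)
                       (trans (lookup∘update′ j≢i Y b)
                         (sym (trans (lookup∘update′ (j≢i ∘ ι-inj) (place ι S Y) b)
                                     (lookup-place-on ι ι-inj S Y j))))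

place-self : (ι : Fin k → Fin n) → Injective _≡_ _≡_ ι → (S : Subset n) (Y : Subset k) →
             (∀ j → lookup S (ι j) ≡ lookup Y j) → place ι S Y ≡ S
place-self ι ι-inj S Y agree = lookup-ext helper
  where
  helper : ∀ e → lookup (place ι S Y) e ≡ lookup S e
  helper e with any? (λ j → ι j ≟ e)
  ... | no e∉ι         = lookup-place-off ι S Y e (λ j eq → e∉ι (j , eq))
  ... | yes (j , refl) = trans (lookup-place-on ι ι-inj S Y j) (sym (agree j))

-- Three neighbours force 𝒲³ or M(K₄)

-- The trace of X on the six chosen elements. Each of the three lines arises from it by one
-- exchange.
ace : Subset 6
ace = inside ∷ outside ∷ inside ∷ outside ∷ inside ∷ outside ∷ []

lines : List (Subset 6)
lines = abc ∷ cde ∷ efa ∷ []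

open DecMembership (≡-dec {A = Bool} {n = 6} Bool._≟_) using () renaming (_∈?_ to _∈ᴸ?_)

NearLine : Subset 6 → Set
NearLine Y = ∃[ i ] ∃[ j ] lookup Y i ≡ inside × lookup Y j ≡ outside × exchange Y i j ∈ᴸ lines

-- The cases are what the matroid can decide: sets too small or too large, the three lines, the free
-- set bdf, and the other 3-sets. The last are adjacent to a line, so stability makes them bases.
Classified : Subset 6 → Set
Classified Y = (∣ Y ∣ < 3 × 𝒲³ Y ≡ true × M[K₄] Y ≡ true)
             ⊎ (3 < ∣ Y ∣ × 𝒲³ Y ≡ false × M[K₄] Y ≡ false)
             ⊎ (Y ∈ᴸ lines × 𝒲³ Y ≡ false × M[K₄] Y ≡ false)
             ⊎ (Y ≡ bdf × 𝒲³ Y ≡ true × M[K₄] Y ≡ false)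
             ⊎ (∣ Y ∣ ≡ 3 × NearLine Y × 𝒲³ Y ≡ true × M[K₄] Y ≡ true)

classify : ∀ Y → Classified Y
classify = toWitness {a? = allSubsets? λ Y →
        ((∣ Y ∣ <? 3) ×-dec (𝒲³ Y Bool.≟ true) ×-dec (M[K₄] Y Bool.≟ true))
  ⊎-dec ((3 <? ∣ Y ∣) ×-dec (𝒲³ Y Bool.≟ false) ×-dec (M[K₄] Y Bool.≟ false))
  ⊎-dec ((Y ∈ᴸ? lines) ×-dec (𝒲³ Y Bool.≟ false) ×-dec (M[K₄] Y Bool.≟ false))
  ⊎-dec (≡-dec Bool._≟_ Y bdf ×-dec (𝒲³ Y Bool.≟ true) ×-dec (M[K₄] Y Bool.≟ false))
  ⊎-dec ((∣ Y ∣ ℕ.≟ 3) ×-dec (any? λ i → any? λ j →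
          (lookup Y i Bool.≟ inside) ×-dec (lookup Y j Bool.≟ outside) ×-dec (exchange Y i j ∈ᴸ? lines))
        ×-dec (𝒲³ Y Bool.≟ true) ×-dec (M[K₄] Y Bool.≟ true))} _

-- The elements a, c, e of the minor are x 0, x 1, x 2; the element b j (labelled false , j)
-- completes the line that misses x j.
label : Fin 6 → Bool × Fin 3
label 0F = true  , 0F
label 1F = false , 2F
label 2F = true  , 1F
label 3F = false , 0F
label 4F = true  , 2F
label 5F = false , 1F

label-injective : ∀ i j → label i ≡ label j → i ≡ j
label-injective = toWitness {a? = all? λ i → all? λ j →
  ×-≡-dec Bool._≟_ _≟_ (label i) (label j) →-dec (i ≟ j)} _

module _ {n} {M : SetSystem n} (sp : IsSparsePaving M) where

  private
    r₀ = rank M ⊤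
    N  = nonbases r₀ M

  open IsMatroid (proj₁ sp)
  open Stable (nonbases-stable sp)

  module _ (X : Subset n) (x b : Fin 3 → Fin n)
           (x-inj : Injective _≡_ _≡_ x) (b-inj : Injective _≡_ _≡_ b)
           (X∋x : ∀ j → lookup X (x j) ≡ inside) (X∌b : ∀ j → lookup X (b j) ≡ outside)
           (Nxb : ∀ j → T (N (exchange X (x j) (b j)))) where

    private
      pick : Bool × Fin 3 → Fin n
      pick (true  , j) = x j
      pick (false , j) = b j

      pick-injective : ∀ p q → pick p ≡ pick q → p ≡ q
      pick-injective (true  , i) (true  , j) eq = cong (true ,_) (x-inj eq)
      pick-injective (false , i) (false , j) eq = cong (false ,_) (b-inj eq)
      pick-injective (true  , i) (false , j) eq = contradiction eq (x≢b X (X∋x i) (X∌b j))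
      pick-injective (false , i) (true  , j) eq = contradiction (sym eq) (x≢b X (X∋x j) (X∌b i))

      ι : Fin 6 → Fin n
      ι = pick ∘ label

      ι-inj : Injective _≡_ _≡_ ι
      ι-inj {i} {j} eq = label-injective i j (pick-injective (label i) (label j) eq)

      at : Subset 6 → Subset n
      at = place ι X

      agree : ∀ i → lookup X (ι i) ≡ lookup ace i
      agree 0F = X∋x 0F
      agree 1F = X∌b 2F
      agree 2F = X∋x 1F
      agree 3F = X∌b 0F
      agree 4F = X∋x 2F
      agree 5F = X∌b 1F

      at-exchange : ∀ Y i j → at (exchange Y i j) ≡ exchange (at Y) (ι i) (ι j)
      at-exchange Y i j = trans (place-update ι ι-inj X (Y [ i ]≔ outside) j inside)
        (cong (_[ ι j ]≔ inside) (place-update ι ι-inj X Y i outside))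

      N-at-line : ∀ {D} → D ∈ᴸ lines → T (N (at D))
      N-at-line D∈ = helper D∈
        where
        from-ace : ∀ i j → at (exchange ace i j) ≡ exchange X (ι i) (ι j)
        from-ace i j = trans (at-exchange ace i j)
          (cong (λ Z → exchange Z (ι i) (ι j)) (place-self ι ι-inj X ace agree))
        helper : ∀ {D} → D ∈ᴸ lines → T (N (at D))
        helper (here refl)                 = subst (T ∘ N) (sym (from-ace 4F 1F)) (Nxb 2F)
        helper (there (here refl))         = subst (T ∘ N) (sym (from-ace 0F 3F)) (Nxb 0F)
        helper (there (there (here refl))) = subst (T ∘ N) (sym (from-ace 2F 5F)) (Nxb 1F)

      -- The 3 counts the elements of X on the image, namely the x j. Comparing ∣Y∣ with 3 thus
      -- becomes comparing ∣at Y∣ with the rank.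
      ∣at∣+3 : ∀ Y → ∣ at Y ∣ + 3 ≡ r₀ + ∣ Y ∣
      ∣at∣+3 Y = begin
        ∣ at Y ∣ + 3
          ≡⟨ cong (∣ at Y ∣ +_) (sum-cong-≗ (λ j → cong 𝟙 (agree j))) ⟨
        ∣ at Y ∣ + sum (λ j → 𝟙 (lookup X (ι j)))
          ≡⟨ ∣place∣ ι ι-inj X Y ⟩
        ∣ X ∣ + ∣ Y ∣
          ≡⟨ cong (_+ ∣ Y ∣) (trans (sym (∣exchange∣ X (X∋x 0F) (X∌b 0F))) (layer _ (Nxb 0F))) ⟩
        r₀ + ∣ Y ∣ ∎
        where open ≡-Reasoning

      dependent : ∀ Y → ¬ Indep M (at Y) → M (at Y) ≡ false
      dependent Y ¬MY = Bool.¬-not (¬MY ∘ Equivalence.from T-≡)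

      small : ∀ Y → ∣ Y ∣ < 3 → M (at Y) ≡ true
      small Y ∣Y∣<3 = Equivalence.to T-≡ (∣∣<rank⇒indep sp (at Y)
        (+-cancelʳ-< 3 _ _ (≤-trans (≤-reflexive (cong suc (∣at∣+3 Y))) (+-monoʳ-< r₀ ∣Y∣<3))))

      large : ∀ Y → 3 < ∣ Y ∣ → M (at Y) ≡ false
      large Y 3<∣Y∣ = dependent Y λ MY → <⇒≱ (+-cancelʳ-< 3 _ _
        (≤-trans (+-monoʳ-< r₀ 3<∣Y∣) (≤-reflexive (sym (∣at∣+3 Y))))) (indep⇒∣∣≤rank sp (at Y) MY)

      line : ∀ Y → Y ∈ᴸ lines → M (at Y) ≡ false
      line Y Y∈ = dependent Y (proj₂ (nonbases⁻ r₀ M (at Y) (N-at-line Y∈)))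

      near : ∀ Y → ∣ Y ∣ ≡ 3 → NearLine Y → M (at Y) ≡ true
      near Y ∣Y∣≡3 (i , j , Y∋i , Y∌j , Y′∈) = Equivalence.to T-≡ (decidable-stable (T? _) λ ¬MY →
        no-edge (at Y) (ι i) (ι j)
          (trans (lookup-place-on ι ι-inj X Y i) Y∋i) (trans (lookup-place-on ι ι-inj X Y j) Y∌j)
          (nonbases⁺ r₀ M (at Y)
            (+-cancelʳ-≡ 3 _ _ (trans (∣at∣+3 Y) (cong (r₀ +_) ∣Y∣≡3))) ¬MY)
          (subst (T ∘ N) (at-exchange Y i j) (N-at-line Y′∈)))

      minor : (L : SetSystem 6) → (∀ Y → M (at Y) ≡ L Y) → HasMinor L M
      minor L M≡L with minor-along M hereditary ι ι-inj (at ⊥)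
                         (Equivalence.from T-≡ (small ⊥ (s≤s z≤n)))
      -- The contracted set `at ⊥` is X without its three elements x j.
      ... | l , M′ , M′≼M , π , eq = l , M′ , M′≼M , π , λ Y → trans (eq Y (at Y) (extends Y)) (M≡L Y)
        where
        extends : ∀ Y → Extends ι (at ⊥) Y (at Y)
        extends Y = record
          { on-image  = lookup-place-on ι ι-inj X Y
          ; off-image = λ e e∉ι → trans (lookup-place-off ι X Y e e∉ι) (sym (lookup-place-off ι X ⊥ e e∉ι))
          }

    -- Only bdf is left open by `classify`; its independence yields 𝒲³ and its dependence M(K₄).
    triangle⇒minor : HasMinor 𝒲³ M ⊎ HasMinor M[K₄] M
    triangle⇒minor with M (at bdf) in eq
    ... | true  = inj₁ (minor 𝒲³ λ Y → match Y (classify Y))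
      where
      match : ∀ Y → Classified Y → M (at Y) ≡ 𝒲³ Y
      match Y (inj₁ (lt , w , _))                              = trans (small Y lt) (sym w)
      match Y (inj₂ (inj₁ (gt , w , _)))                       = trans (large Y gt) (sym w)
      match Y (inj₂ (inj₂ (inj₁ (Y∈ , w , _))))                = trans (line Y Y∈) (sym w)
      match Y (inj₂ (inj₂ (inj₂ (inj₁ (refl , w , _)))))       = trans eq (sym w)
      match Y (inj₂ (inj₂ (inj₂ (inj₂ (∣Y∣≡3 , nl , w , _))))) = trans (near Y ∣Y∣≡3 nl) (sym w)
    ... | false = inj₂ (minor M[K₄] λ Y → match Y (classify Y))
      where
      match : ∀ Y → Classified Y → M (at Y) ≡ M[K₄] Y
      match Y (inj₁ (lt , _ , w))                              = trans (small Y lt) (sym w)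
      match Y (inj₂ (inj₁ (gt , _ , w)))                       = trans (large Y gt) (sym w)
      match Y (inj₂ (inj₂ (inj₁ (Y∈ , _ , w))))                = trans (line Y Y∈) (sym w)
      match Y (inj₂ (inj₂ (inj₂ (inj₁ (refl , _ , w)))))       = trans eq (sym w)
      match Y (inj₂ (inj₂ (inj₂ (inj₂ (∣Y∣≡3 , nl , _ , w))))) = trans (near Y ∣Y∣≡3 nl) (sym w)

  -- Neighbour counts in the absence of both minors

  private
    term : Subset n → Fin n → Fin n → ℕ
    term X x b = 𝟙 (lookup X x) * (𝟙 (not (lookup X b)) * 𝟙 (N (exchange X x b)))

    term≤1 : ∀ X x b → term X x b ≤ 1
    term≤1 X x b = *-mono-≤ (𝟙≤1 (lookup X x)) (*-mono-≤ (𝟙≤1 (not (lookup X b))) (𝟙≤1 (N (exchange X x b))))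

    Neighbour : Subset n → Fin n → Fin n → Set
    Neighbour X x b = lookup X x ≡ inside × lookup X b ≡ outside × T (N (exchange X x b))

    term>0 : ∀ X x b → 0 < term X x b → Neighbour X x b
    term>0 X x b pos with lookup X x | lookup X b | N (exchange X x b)
    ... | true | false | true = refl , refl , _

    row : Subset n → Fin n → ℕ
    row X x = sum (term X x)

    same-x⇒same-b : ∀ {X x b c} → Neighbour X x b → Neighbour X x c → b ≡ c
    same-x⇒same-b {X} {x} {b} {c} (X∋x , X∌b , Nb) (_ , X∌c , Nc) = decidable-stable (b ≟ c) λ b≢c →
      no-edge (exchange X x b) b c (lookup-exchange-in X x b)
        (trans (lookup-exchange-other X (x≢b X X∋x X∌c ∘ sym) (b≢c ∘ sym)) X∌c) Nb
        (subst (T ∘ N) (sym (exchange-exchange-in X (x≢b X X∋x X∌b) X∌b)) Nc)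

    same-b⇒same-x : ∀ {X x y b} → Neighbour X x b → Neighbour X y b → x ≡ y
    same-b⇒same-x {X} {x} {y} {b} (X∋x , X∌b , Nx) (X∋y , _ , Ny) = decidable-stable (x ≟ y) λ x≢y →
      no-edge (exchange X x b) y x
        (trans (lookup-exchange-other X (x≢y ∘ sym) (x≢b X X∋y X∌b)) X∋y)
        (lookup-exchange-out X (x≢b X X∋x X∌b)) Nx
        (subst (T ∘ N) (sym (exchange-exchange-out X x≢y (x≢b X X∋x X∌b) (x≢b X X∋y X∌b) X∋x)) Ny)

    row≤1 : ∀ X x → row X x ≤ 1
    row≤1 X x = ≮⇒≥ λ 1<row → absurd (support (term X x) (term≤1 X x) 2 1<row)
      where
      absurd : ¬ (∃[ g ] (Injective {A = Fin 2} {B = Fin n} _≡_ _≡_ g × (∀ j → 0 < term X x (g j))))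
      absurd (g , g-inj , pos)
        with g-inj (same-x⇒same-b (term>0 X x (g 0F) (pos 0F)) (term>0 X x (g 1F) (pos 1F)))
      ... | ()

    row>0 : ∀ X x → 0 < row X x → ∃[ b ] Neighbour X x b
    row>0 X x pos with support (term X x) (term≤1 X x) 1 pos
    ... | g , _ , pos′ = g 0F , term>0 X x (g 0F) (pos′ 0F)

  module _ (no-minor : ¬ (HasMinor 𝒲³ M ⊎ HasMinor M[K₄] M)) where

    private
      neighbours≤2 : ∀ X → sum (row X) ≤ 2
      neighbours≤2 X = ≮⇒≥ λ 2<sum → no-minor (build (support (row X) (row≤1 X) 3 2<sum))
        where
        build : ∃[ g ] (Injective {A = Fin 3} {B = Fin n} _≡_ _≡_ g × (∀ j → 0 < row X (g j))) →
                HasMinor 𝒲³ M ⊎ HasMinor M[K₄] M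
        build (g , g-inj , pos) = triangle⇒minor X g (proj₁ ∘ nb) g-inj
          (λ {i} {j} eq → g-inj (same-b⇒same-x (proj₂ (nb i)) (subst (Neighbour X (g j)) (sym eq) (proj₂ (nb j)))))
          (proj₁ ∘ proj₂ ∘ nb) (proj₁ ∘ proj₂ ∘ proj₂ ∘ nb) (proj₂ ∘ proj₂ ∘ proj₂ ∘ nb)
          where
          nb : ∀ j → ∃[ b ] Neighbour X (g j) b
          nb j = row>0 X (g j) (pos j)

      -- Exchanges preserve size, so sets off the layer r₀ have no neighbour in `N`. The indicator
      -- is what later sums to n C r₀.
      neighbours≤ : ∀ X → sum (row X) ≤ 2 * 𝟙 (∣ X ∣ ≡ᵇ r₀)
      neighbours≤ X with ∣ X ∣ ≡ᵇ r₀ in eq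
      ... | true  = neighbours≤2 X
      ... | false = ≮⇒≥ λ 0<sum → absurd (support (row X) (row≤1 X) 1 0<sum)
        where
        absurd : ¬ (∃[ g ] (Injective {A = Fin 1} {B = Fin n} _≡_ _≡_ g × (∀ j → 0 < row X (g j))))
        absurd (g , _ , pos) with row>0 X (g 0F) (pos 0F)
        ... | b , X∋x , X∌b , Nxb = subst T eq
          (≡⇒≡ᵇ _ _ (trans (sym (∣exchange∣ X X∋x X∌b)) (layer _ Nxb)))

    size-nonbases-≤ : (n ∸ r₀) * r₀ * size N ≤ 2 * (n C r₀)
    size-nonbases-≤ = begin
      (n ∸ r₀) * r₀ * size N
        ≡⟨ ∑ˢ-distribˡ-* ((n ∸ r₀) * r₀) (𝟙 ∘ N) ⟨
      ∑ˢ (λ X → (n ∸ r₀) * r₀ * 𝟙 (N X))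
        -- Members of `N` have size r₀, so the constant factor may be replaced by the one that
        -- depends on X in `∑ˢ-exchanges`.
        ≡⟨ ∑ˢ-cong on-layer ⟩
      ∑ˢ (λ X → (n ∸ ∣ X ∣) * ∣ X ∣ * 𝟙 (N X))
        ≡⟨ ∑ˢ-exchanges (𝟙 ∘ N) ⟨
      ∑ˢ (λ X → sum (row X))
        ≤⟨ ∑ˢ-mono-≤ neighbours≤ ⟩
      ∑ˢ {n} (λ X → 2 * 𝟙 (∣ X ∣ ≡ᵇ r₀))
        ≡⟨ ∑ˢ-distribˡ-* {n} 2 (λ X → 𝟙 (∣ X ∣ ≡ᵇ r₀)) ⟩
      2 * ∑ˢ {n} (λ X → 𝟙 (∣ X ∣ ≡ᵇ r₀))
        ≡⟨ cong (2 *_) (∑ˢ-layer n r₀) ⟩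
      2 * (n C r₀) ∎
      where
      open ≤-Reasoning
      on-layer : ∀ X → (n ∸ r₀) * r₀ * 𝟙 (N X) ≡ (n ∸ ∣ X ∣) * ∣ X ∣ * 𝟙 (N X)
      on-layer X with N X in eq
      ... | true  = cong (λ z → (n ∸ z) * z * 1) (sym (layer X (Equivalence.from T-≡ eq)))
      ... | false = trans (*-zeroʳ ((n ∸ r₀) * r₀)) (sym (*-zeroʳ ((n ∸ ∣ X ∣) * ∣ X ∣)))

-- Comparing counts of set systems up to pointwise equality

Any-─ : {x z : SetSystem n} {ys : List (SetSystem n)} → ¬ (x ≗ z) → Any (z ≗_) ys →
        (p : Any (x ≗_) ys) → Any (z ≗_) (ys ─ p)
Any-─ x≉z (here z≗y) (here x≗y) = contradiction (λ X → trans (x≗y X) (sym (z≗y X))) x≉z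
Any-─ x≉z (here z≗y) (there p)  = here z≗y
Any-─ x≉z (there q)  (here _)   = q
Any-─ x≉z (there q)  (there p)  = there (Any-─ x≉z q p)

length-─ : {P : Pred A 0ℓ} {ys : List A} (p : Any P ys) → length ys ≡ suc (length (ys ─ p))
length-─ (here _)  = refl
length-─ (there p) = cong suc (length-─ p)

-- Pigeonhole by deletion: each image uses up its own entry of ys, and the later images, being
-- different from it, keep theirs.
length-injective-≤ : (f : A → SetSystem n) (xs : List A) (ys : List (SetSystem n)) →
  AllPairs (λ x x′ → ¬ (f x ≗ f x′)) xs → All (λ x → Any (f x ≗_) ys) xs → length xs ≤ length ys
length-injective-≤ f []       ys _          _         = z≤n
length-injective-≤ f (x ∷ xs) ys (≢x ∷ uniq) (p ∷ ps) = begin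
  suc (length xs)         ≤⟨ s≤s (length-injective-≤ f xs (ys ─ p) uniq
                               (All.zipWith (λ (fx≉fz , q) → Any-─ fx≉fz q p) (≢x , ps))) ⟩
  suc (length (ys ─ p))   ≡⟨ length-─ p ⟨
  length ys               ∎
  where open ≤-Reasoning

module _ {P Q : Pred (SetSystem n) 0ℓ} (P? : Decidable P) (Q? : Decidable Q)
         (f : SetSystem n → SetSystem n)
         (P⇒Q : ∀ {F} G → P F → f F ≗ G → Q G)
         (f-injective : ∀ {F G} → P F → P G → f F ≗ f G → F ≗ G) where

  -- The enumeration contains f F only up to `≗`, which is why Q is demanded of every G pointwise
  -- equal to f F.
  numSystems-≤ : length (filter P? (setSystems n)) ≤ length (filter Q? (setSystems n))
  numSystems-≤ = length-injective-≤ f _ _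
    (separated (All.all-filter P? (setSystems n))
               (Unique.filter⁺ (SetSystemSetoid n) P? (setSystems-unique n)))
    (All.map (λ {F} p → keep p (∈-setSystems n (f F))) (All.all-filter P? (setSystems n)))
    where
    separated : ∀ {Fs} → All P Fs → AllPairs (λ F G → ¬ (F ≗ G)) Fs →
                AllPairs (λ F G → ¬ (f F ≗ f G)) Fs
    separated []       []           = []
    separated (p ∷ ps) (≢F ∷ uniq) =
      All.zipWith (λ (q , F≉G) fF≗fG → F≉G (f-injective p q fF≗fG)) (ps , ≢F) ∷ separated ps uniq
    keep : ∀ {F Gs} → P F → Any (f F ≗_) Gs → Any (f F ≗_) (filter Q? Gs)
    keep {Gs = G ∷ Gs} p (here eq) with Q? G
    ... | yes _ = here eq
    ... | no ¬q = contradiction (P⇒Q G p eq) ¬q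
    keep {Gs = G ∷ Gs} p (there q) with Q? G
    ... | yes _ = there (keep p q)
    ... | no _  = keep p q

length-filter-∷ : {P : Pred A 0ℓ} (P? : Decidable P) → ∀ x xs →
  length (filter P? (x ∷ xs)) ≡ 𝟙 (does (P? x)) + length (filter P? xs)
length-filter-∷ P? x xs with P? x
... | yes _ = refl
... | no _  = refl

length-filter-mono : {P Q : Pred A 0ℓ} (P? : Decidable P) (Q? : Decidable Q) →
  (∀ {x} → P x → Q x) → ∀ xs → length (filter P? xs) ≤ length (filter Q? xs)
length-filter-mono P? Q? P⇒Q []       = z≤n
length-filter-mono P? Q? P⇒Q (x ∷ xs) with P? x | Q? x
... | yes _ | yes _ = s≤s (length-filter-mono P? Q? P⇒Q xs)
... | yes p | no ¬q = contradiction (P⇒Q p) ¬q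
... | no _  | yes _ = m≤n⇒m≤1+n (length-filter-mono P? Q? P⇒Q xs)
... | no _  | no _  = length-filter-mono P? Q? P⇒Q xs

length-filter-⊎ : {P Q R : Pred A 0ℓ} (P? : Decidable P) (Q? : Decidable Q) (R? : Decidable R) →
  (∀ {x} → P x → Q x ⊎ R x) → ∀ xs →
  length (filter P? xs) ≤ length (filter Q? xs) + length (filter R? xs)
length-filter-⊎ P? Q? R? split []       = z≤n
length-filter-⊎ P? Q? R? split (x ∷ xs)
  rewrite length-filter-∷ P? x xs | length-filter-∷ Q? x xs | length-filter-∷ R? x xs = begin
  𝟙 p + length (filter P? xs)
    ≤⟨ +-mono-≤ pointwise (length-filter-⊎ P? Q? R? split xs) ⟩
  𝟙 q + 𝟙 r + (length (filter Q? xs) + length (filter R? xs))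
    ≡⟨ interchange (𝟙 q) (𝟙 r) (length (filter Q? xs)) (length (filter R? xs)) ⟩
  𝟙 q + length (filter Q? xs) + (𝟙 r + length (filter R? xs)) ∎
  where
  open ≤-Reasoning
  p = does (P? x)
  q = does (Q? x)
  r = does (R? x)
  interchange : ∀ a b c d → a + b + (c + d) ≡ a + c + (b + d)
  interchange = solve-∀
  pointwise : 𝟙 p ≤ 𝟙 q + 𝟙 r
  pointwise with P? x
  ... | no _   = z≤n
  ... | yes Px with split Px
  ...   | inj₁ Qx rewrite dec-true (Q? x) Qx = s≤s z≤n
  ...   | inj₂ Rx rewrite dec-true (R? x) Rx = m≤n+m 1 (𝟙 q)

length-filter-fibres : {P : Pred A 0ℓ} (P? : Decidable P) (ρ : A → ℕ) (u : ℕ) (xs : List A) →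
  (∀ i → length (filter (λ x → P? x ×-dec (ρ x ℕ.≟ i)) xs) ≤ u) →
  ∀ m → length (filter (λ x → P? x ×-dec (ρ x <? m)) xs) ≤ m * u
length-filter-fibres P? ρ u xs fibre zero    =
  ≤-reflexive (cong length (filter-none _ (All.universal (λ x (_ , ρx<0) → n≮0 ρx<0) xs)))
length-filter-fibres P? ρ u xs fibre (suc m) = ≤-trans
  (length-filter-⊎ _ (λ x → P? x ×-dec (ρ x ℕ.≟ m)) (λ x → P? x ×-dec (ρ x <? m)) split xs)
  (+-mono-≤ (fibre m) (length-filter-fibres P? ρ u xs fibre m))
  where
  split : ∀ {x} → _ × ρ x < suc m → (_ × ρ x ≡ m) ⊎ (_ × ρ x < m)
  split (Px , ρx<1+m) with m<1+n⇒m<n∨m≡n ρx<1+m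
  ... | inj₁ ρx<m = inj₂ (Px , ρx<m)
  ... | inj₂ ρx≡m = inj₁ (Px , ρx≡m)

-- The middle layer and the Graham-Sloane lower bound

sum-δ : ∀ m a → a < m → sum {m} (λ k → 𝟙 (a ≡ᵇ toℕ k)) ≡ 1
sum-δ (suc m) zero    _         = cong suc (trans (sum-const m 0) (*-zeroʳ m))
sum-δ (suc m) (suc a) (s≤s a<m) = sum-δ m a a<m

-- The n + 1 layers exhaust the subsets and none exceeds the middle one. This is cruder than
-- Stirling's estimate, and the choice of j later makes up for it.
2^n≤[1+n]*nC⌊n/2⌋ : ∀ n → 2 ^ n ≤ suc n * (n C ⌊ n /2⌋)
2^n≤[1+n]*nC⌊n/2⌋ n = begin
  2 ^ n
    ≡⟨ *-identityʳ (2 ^ n) ⟨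
  2 ^ n * 1
    ≡⟨ ∑ˢ-const n 1 ⟨
  ∑ˢ {n} (λ _ → 1)
    ≡⟨ ∑ˢ-cong (λ X → sum-δ (suc n) ∣ X ∣ (s≤s (∣p∣≤n X))) ⟨
  ∑ˢ {n} (λ X → sum {suc n} (λ k → 𝟙 (∣ X ∣ ≡ᵇ toℕ k)))
    ≡⟨ ∑ˢ-∑-comm {n} {suc n} (λ X k → 𝟙 (∣ X ∣ ≡ᵇ toℕ k)) ⟩
  sum {suc n} (λ k → ∑ˢ {n} (λ X → 𝟙 (∣ X ∣ ≡ᵇ toℕ k)))
    ≤⟨ sum-mono-≤ {suc n} (λ k → ≤-trans (≤-reflexive (∑ˢ-layer n (toℕ k))) (nCk≤nC⌊n/2⌋ n (toℕ k))) ⟩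
  sum {suc n} (λ _ → n C ⌊ n /2⌋)
    ≡⟨ sum-const (suc n) (n C ⌊ n /2⌋) ⟩
  suc n * (n C ⌊ n /2⌋) ∎
  where open ≤-Reasoning

-- Graham and Sloane: an exchange of x for b changes the sum of the elements by b - x,
-- which is nonzero modulo n.
residueClass : (r : ℕ) → Fin (suc n) → SetSystem (suc n)
residueClass {n} r j X = (∣ X ∣ ≡ᵇ r) ∧ (weight toℕ X % suc n ≡ᵇ toℕ j)

residueClass-stable : ∀ r (j : Fin (suc n)) → Stable r (residueClass r j)
residueClass-stable {n} r j = record
  { layer   = λ X RX → ≡ᵇ⇒≡ _ _ (proj₁ (Equivalence.to T-∧ RX))
  ; no-edge = λ X x b X∋x X∌b RX RX′ → x≢b X X∋x X∌b (toℕ-injective (residues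
      (weight toℕ (exchange X x b)) (weight toℕ X) (toℕ x) (toℕ b) (toℕ<n x) (toℕ<n b)
      (trans (residue (exchange X x b) RX′) (sym (residue X RX))) (weight-exchange X X∋x X∌b toℕ)))
  }
  where
  residue : ∀ X → T (residueClass r j X) → weight toℕ X % suc n ≡ toℕ j
  residue X RX = ≡ᵇ⇒≡ _ _ (proj₂ (Equivalence.to T-∧ RX))
  -- Cancelling the common remainder in u + x = v + b leaves x and b congruent modulo suc n, and
  -- both are below the modulus.
  residues : ∀ u v x b → x < suc n → b < suc n → u % suc n ≡ v % suc n → u + x ≡ v + b → x ≡ b
  residues u v x b x<n b<n u≡v u+x≡v+b = begin
    x                               ≡⟨ m<n⇒m%n≡m x<n ⟨
    x % suc n                       ≡⟨ [m+kn]%n≡m%n x (u / suc n) (suc n) ⟨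
    (x + u / suc n * suc n) % suc n ≡⟨ cong (_% suc n) cancelled ⟩
    (b + v / suc n * suc n) % suc n ≡⟨ [m+kn]%n≡m%n b (v / suc n) (suc n) ⟩
    b % suc n                       ≡⟨ m<n⇒m%n≡m b<n ⟩
    b                               ∎
    where
    open ≡-Reasoning
    rotate : ∀ p q x → p + (x + q) ≡ p + q + x
    rotate = solve-∀
    cancelled : x + u / suc n * suc n ≡ b + v / suc n * suc n
    cancelled = +-cancelˡ-≡ (u % suc n) _ _ (begin
      u % suc n + (x + u / suc n * suc n) ≡⟨ rotate (u % suc n) (u / suc n * suc n) x ⟩
      u % suc n + u / suc n * suc n + x   ≡⟨ cong (_+ x) (m≡m%n+[m/n]*n u (suc n)) ⟨
      u + x                               ≡⟨ u+x≡v+b ⟩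
      v + b                               ≡⟨ cong (_+ b) (m≡m%n+[m/n]*n v (suc n)) ⟩
      v % suc n + v / suc n * suc n + b   ≡⟨ rotate (v % suc n) (v / suc n * suc n) b ⟨
      v % suc n + (b + v / suc n * suc n) ≡⟨ cong (_+ (b + v / suc n * suc n)) u≡v ⟨
      u % suc n + (b + v / suc n * suc n) ∎)

∑-size-residueClass : ∀ n r → sum (λ j → size (residueClass {n} r j)) ≡ suc n C r
∑-size-residueClass n r = begin
  sum (λ j → ∑ˢ (λ X → 𝟙 (residueClass {n} r j X)))
    ≡⟨ ∑ˢ-∑-comm {suc n} {suc n} (λ X j → 𝟙 (residueClass {n} r j X)) ⟨
  ∑ˢ (λ X → sum (λ j → 𝟙 (residueClass {n} r j X)))
    ≡⟨ ∑ˢ-cong {suc n} (λ X → one-residue (∣ X ∣ ≡ᵇ r) (weight toℕ X)) ⟩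
  ∑ˢ {suc n} (λ X → 𝟙 (∣ X ∣ ≡ᵇ r))
    ≡⟨ ∑ˢ-layer (suc n) r ⟩
  suc n C r ∎
  where
  open ≡-Reasoning
  one-residue : ∀ c w → sum {suc n} (λ j → 𝟙 (c ∧ (w % suc n ≡ᵇ toℕ j))) ≡ 𝟙 c
  one-residue true  w = sum-δ (suc n) (w % suc n) (m%n<n w (suc n))
  one-residue false w = trans (sum-const (suc n) 0) (*-zeroʳ (suc n))

withNonbases : ℕ → SetSystem n → SetSystem n
withNonbases r 𝓖 X = (∣ X ∣ ≤ᵇ r) ∧ not (𝓖 X)

withNonbases-avoids : ∀ {r} {𝓖 M : SetSystem n} → withNonbases r 𝓖 ≗ M → Avoids r 𝓖 M
withNonbases-avoids {r = r} {𝓖} {M} eq = record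
  { size≤  = λ X MX → ≤ᵇ⇒≤ _ _ (proj₁ (from-indep X MX))
  ; avoids = λ X MX 𝓖X → subst (T ∘ not) (Equivalence.to T-≡ 𝓖X) (proj₂ (from-indep X MX))
  ; indep  = λ X ∣X∣≤r ¬𝓖X → subst T (eq X) (Equivalence.from T-∧
      (≤⇒≤ᵇ ∣X∣≤r , Equivalence.from T-≡ (cong not (Bool.¬-not (¬𝓖X ∘ Equivalence.from T-≡)))))
  }
  where
  from-indep : ∀ X → Indep M X → T (∣ X ∣ ≤ᵇ r) × T (not (𝓖 X))
  from-indep X MX = Equivalence.to T-∧ (subst T (sym (eq X)) MX)

stable-⊆ : ∀ {r} {𝓒 𝓖 : SetSystem n} → (∀ X → T (𝓖 X) → T (𝓒 X)) → Stable r 𝓒 → Stable r 𝓖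
stable-⊆ 𝓖⊆𝓒 st = record
  { layer   = λ X 𝓖X → layer X (𝓖⊆𝓒 X 𝓖X)
  ; no-edge = λ X x b X∋x X∌b 𝓖X 𝓖X′ → no-edge X x b X∋x X∌b (𝓖⊆𝓒 X 𝓖X) (𝓖⊆𝓒 _ 𝓖X′)
  }
  where open Stable st

-- Different subfamilies 𝓖 of 𝓒 give different matroids, because a member of 𝓒 is independent
-- exactly when 𝓖 omits it.
stable⇒2^size≤numSparsePaving : ∀ {r} {𝓒 : SetSystem n} → Stable r 𝓒 → 0 < r → r < n →
                                2 ^ size 𝓒 ≤ numSparsePaving n
stable⇒2^size≤numSparsePaving {n} {r} {𝓒} st 0<r r<n = ≤-trans (≤-reflexive (sym (numSubfamilies 𝓒)))
  (numSystems-≤ (T? ∘ subfamily 𝓒) isSparsePaving? (withNonbases r)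
    (λ {𝓖} M sub eq → avoids⇒isSparsePaving (stable-⊆ (subfamily⇒⊆ 𝓒 𝓖 sub) st) (withNonbases-avoids eq) 0<r r<n)
    (λ {𝓕} {𝓖} sub𝓕 sub𝓖 eq X → recover (subfamily⇒⊆ 𝓒 𝓕 sub𝓕 X) (subfamily⇒⊆ 𝓒 𝓖 sub𝓖 X) (eq X)))
  where
  ∣∣≤ᵇr : ∀ X → T (𝓒 X) → (∣ X ∣ ≤ᵇ r) ≡ true
  ∣∣≤ᵇr X 𝓒X = Equivalence.to T-≡ (≤⇒≤ᵇ (≤-reflexive (Stable.layer st X 𝓒X)))
  recover : ∀ {X 𝓕X 𝓖X} → (T 𝓕X → T (𝓒 X)) → (T 𝓖X → T (𝓒 X)) →
            (∣ X ∣ ≤ᵇ r) ∧ not 𝓕X ≡ (∣ X ∣ ≤ᵇ r) ∧ not 𝓖X → 𝓕X ≡ 𝓖X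
  recover {X} {𝓕X} {𝓖X} 𝓕⇒𝓒 𝓖⇒𝓒 eq with 𝓕X | 𝓖X
  ... | true  | true  = refl
  ... | false | false = refl
  ... | true  | false = contradiction (trans (sym (Bool.∧-zeroʳ _)) (trans eq (cong (_∧ true) (∣∣≤ᵇr X (𝓕⇒𝓒 _))))) λ ()
  ... | false | true  = contradiction (trans (sym (Bool.∧-zeroʳ _)) (trans (sym eq) (cong (_∧ true) (∣∣≤ᵇr X (𝓖⇒𝓒 _))))) λ ()

-- The suc n residue classes partition the r-sets, so a largest one has at least the average size.
numSparsePaving-lower : ∀ n r → 0 < r → r < suc n →
  ∃[ c ] (suc n C r ≤ suc n * c × 2 ^ c ≤ numSparsePaving (suc n))
numSparsePaving-lower n r 0<r r<1+n = size (residueClass r j) ,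
  ≤-trans (≤-reflexive (sym (∑-size-residueClass n r))) (proj₂ largest) ,
  stable⇒2^size≤numSparsePaving (residueClass-stable r j) 0<r r<1+n
  where
  largest = sum≤n*max (λ j → size (residueClass {n} r j))
  j = proj₁ largest

-- Upper bound for matroids without the two minors

nonbases-injective : ∀ {r} {M M′ : SetSystem n} → IsSparsePaving M → IsSparsePaving M′ →
  rank M ⊤ ≡ r → rank M′ ⊤ ≡ r → nonbases r M ≗ nonbases r M′ → M ≗ M′
nonbases-injective {n} {r} {M} {M′} sp sp′ rk rk′ eq X with <-cmp ∣ X ∣ r
... | tri< lt _ _ = trans (indep sp rk) (sym (indep sp′ rk′))
  where
  indep : ∀ {M} → IsSparsePaving M → rank M ⊤ ≡ r → M X ≡ true
  indep sp refl = Equivalence.to T-≡ (∣∣<rank⇒indep sp X lt)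
... | tri> _ _ gt = trans (dep sp rk) (sym (dep sp′ rk′))
  where
  dep : ∀ {M} → IsSparsePaving M → rank M ⊤ ≡ r → M X ≡ false
  dep sp refl = Bool.¬-not λ MX → <⇒≱ gt (indep⇒∣∣≤rank sp X (Equivalence.from T-≡ MX))
... | tri≈ _ ∣X∣≡r _ = Bool.not-injective (begin
  not (M X)                      ≡⟨ cong (_∧ not (M X)) on ⟨
  (∣ X ∣ ≡ᵇ r) ∧ not (M X)       ≡⟨ eq X ⟩
  (∣ X ∣ ≡ᵇ r) ∧ not (M′ X)      ≡⟨ cong (_∧ not (M′ X)) on ⟩
  not (M′ X)                     ∎)
  where
  open ≡-Reasoning
  on : (∣ X ∣ ≡ᵇ r) ≡ true
  on = Equivalence.to T-≡ (≡⇒≡ᵇ _ _ ∣X∣≡r)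

module _ (n K : ℕ)
  (small : ∀ {M : SetSystem n} → IsSparsePaving M → ¬ (HasMinor 𝒲³ M ⊎ HasMinor M[K₄] M) →
           size (nonbases (rank M ⊤) M) ≤ K) where

  private
    𝒳? = λ (M : SetSystem n) → isSparsePaving? M ×-dec ¬? (hasMinor? 𝒲³ M ⊎-dec hasMinor? M[K₄] M)
    numSmall = length (filter (λ 𝓕 → size 𝓕 ≤? K) (setSystems n))

  -- The factor counts the ranks 0 to n; within one rank the nonbases determine the matroid.
  numSparsePaving-𝒳-upper : numSparsePaving-𝒳 n ≤ suc n * numSmall
  numSparsePaving-𝒳-upper = ≤-trans
    (length-filter-mono 𝒳? (λ M → 𝒳? M ×-dec (rank M ⊤ <? suc n)) (λ {M} p → p , s≤s (rank≤n M)) (setSystems n))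
    (length-filter-fibres 𝒳? (λ M → rank M ⊤) numSmall (setSystems n) fibre (suc n))
    where
    rank≤n : ∀ M → rank M ⊤ ≤ n
    rank≤n M = rank≤ M ⊤ n λ I _ _ → ∣p∣≤n I
    fibre : ∀ r → length (filter (λ M → 𝒳? M ×-dec (rank M ⊤ ℕ.≟ r)) (setSystems n)) ≤ numSmall
    fibre r = numSystems-≤ (λ M → 𝒳? M ×-dec (rank M ⊤ ℕ.≟ r)) (λ 𝓕 → size 𝓕 ≤? K) (nonbases r)
      (λ { {M} 𝓕 ((sp , no-minor) , refl) eq →
           ≤-trans (≤-reflexive (∑ˢ-cong (λ X → cong 𝟙 (sym (eq X))))) (small sp no-minor) })
      (λ ((sp , _) , rk) ((sp′ , _) , rk′) → nonbases-injective sp sp′ rk rk′)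

size-nonbases≤layer : ∀ r (M : SetSystem n) → size (nonbases r M) ≤ n C r
size-nonbases≤layer {n} r M = ≤-trans (∑ˢ-mono-≤ (λ X → 𝟙-∧≤ (∣ X ∣ ≡ᵇ r) (not (M X))))
                                      (≤-reflexive (∑ˢ-layer n r))
  where
  𝟙-∧≤ : ∀ a b → 𝟙 (a ∧ b) ≤ 𝟙 a
  𝟙-∧≤ true  b = 𝟙≤1 b
  𝟙-∧≤ false b = z≤n

module _ {n L : ℕ} (n≤2^L : n ≤ 2 ^ L) (12L≤n : 12 * L ≤ n) where

  -- n² ≤ 2^(2L), and from k ≤ n/6 there is room for 2L doublings below n/3 because 12L ≤ n.
  n²*outer-layer≤central : ∀ k → 6 * k ≤ n → n * n * (n C k) ≤ n C ⌊ n /2⌋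
  n²*outer-layer≤central k 6k≤n = begin
    n * n * (n C k)           ≤⟨ *-monoˡ-≤ (n C k) (*-mono-≤ n≤2^L n≤2^L) ⟩
    2 ^ L * 2 ^ L * (n C k)   ≡⟨ cong (_* (n C k)) (^-distribˡ-+-* 2 L L) ⟨
    2 ^ (L + L) * (n C k)     ≤⟨ 2^e*nCk≤nC[k+e] n k (L + L) 3[k+2L]≤n ⟩
    n C (k + (L + L))         ≤⟨ nCk≤nC⌊n/2⌋ n (k + (L + L)) ⟩
    n C ⌊ n /2⌋               ∎
    where
    open ≤-Reasoning
    double : ∀ k L → 2 * (3 * (k + (L + L))) ≡ 6 * k + 12 * L
    double = solve-∀
    3[k+2L]≤n : 3 * (k + (L + L)) ≤ n
    3[k+2L]≤n = *-cancelˡ-≤ 2 (begin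
      2 * (3 * (k + (L + L)))   ≡⟨ double k L ⟩
      6 * k + 12 * L            ≤⟨ +-mono-≤ 6k≤n 12L≤n ⟩
      n + n                     ≡⟨ cong (n +_) (+-identityʳ n) ⟨
      2 * n                     ∎)

  -- If r or n - r is at most n/6, the whole layer is small enough. Otherwise n² ≤ 36 (n - r) r, and
  -- the edge count contributes the remaining 2 of 72 = 36 * 2.
  n²*size-nonbases≤72*central : {M : SetSystem n} → IsSparsePaving M → ¬ (HasMinor 𝒲³ M ⊎ HasMinor M[K₄] M) →
                                n * n * size (nonbases (rank M ⊤) M) ≤ 72 * (n C ⌊ n /2⌋)
  n²*size-nonbases≤72*central {M} sp no-minor with 6 * rank M ⊤ ≤? n | 6 * (n ∸ rank M ⊤) ≤? n
  ... | yes 6r≤n | _ = begin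
    n * n * size (nonbases (rank M ⊤) M)   ≤⟨ *-monoʳ-≤ (n * n) (size-nonbases≤layer (rank M ⊤) M) ⟩
    n * n * (n C rank M ⊤)                 ≤⟨ n²*outer-layer≤central (rank M ⊤) 6r≤n ⟩
    n C ⌊ n /2⌋                            ≤⟨ m≤n*m _ 72 ⟩
    72 * (n C ⌊ n /2⌋)                     ∎
    where open ≤-Reasoning
  ... | no _ | yes 6[n∸r]≤n = begin
    n * n * size (nonbases (rank M ⊤) M)   ≤⟨ *-monoʳ-≤ (n * n) (size-nonbases≤layer (rank M ⊤) M) ⟩
    n * n * (n C rank M ⊤)                 ≡⟨ cong (n * n *_) (nCk≡nC[n∸k] (rank≤ M ⊤ n λ I _ _ → ∣p∣≤n I)) ⟩
    n * n * (n C (n ∸ rank M ⊤))           ≤⟨ n²*outer-layer≤central (n ∸ rank M ⊤) 6[n∸r]≤n ⟩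
    n C ⌊ n /2⌋                            ≤⟨ m≤n*m _ 72 ⟩
    72 * (n C ⌊ n /2⌋)                     ∎
    where open ≤-Reasoning
  ... | no 6r≰n | no 6[n∸r]≰n = begin
    n * n * s                              ≤⟨ *-monoˡ-≤ s (*-mono-≤ (<⇒≤ (≰⇒> 6[n∸r]≰n)) (<⇒≤ (≰⇒> 6r≰n))) ⟩
    6 * (n ∸ r) * (6 * r) * s              ≡⟨ regroup (n ∸ r) r s ⟩
    36 * ((n ∸ r) * r * s)                 ≤⟨ *-monoʳ-≤ 36 (size-nonbases-≤ sp no-minor) ⟩
    36 * (2 * (n C r))                     ≡⟨ *-assoc 36 2 (n C r) ⟨
    72 * (n C r)                           ≤⟨ *-monoʳ-≤ 72 (nCk≤nC⌊n/2⌋ n r) ⟩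
    72 * (n C ⌊ n /2⌋)                     ∎
    where
    open ≤-Reasoning
    r = rank M ⊤
    s = size (nonbases r M)
    regroup : ∀ a b c → 6 * a * (6 * b) * c ≡ 36 * (a * b * c)
    regroup = solve-∀

-- Exponents in the final comparison

-- `numSmall-bound` at m = 2^(1+j). For fixed n = j + e, raising j enlarges the first term of the
-- exponent and shrinks the second.
numSmall≤ : ∀ j e K → length (filter (λ 𝓕 → size 𝓕 ≤? K) (setSystems (j + e))) ≤ 2 ^ (suc j * K + 2 ^ e)
numSmall≤ j e K = *-cancelʳ-≤ _ _ (m ^ 2 ^ (j + e)) (begin
  U * m ^ 2 ^ (j + e)                             ≤⟨ numSmall-bound m K (j + e) ⟩
  m ^ K * suc m ^ 2 ^ (j + e)                     ≤⟨ *-monoʳ-≤ (m ^ K) ([1+2^1+j]^2^[j+e] j e) ⟩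
  m ^ K * (2 ^ 2 ^ e * m ^ 2 ^ (j + e))           ≡⟨ *-assoc (m ^ K) (2 ^ 2 ^ e) _ ⟨
  m ^ K * 2 ^ 2 ^ e * m ^ 2 ^ (j + e)             ≡⟨ cong (λ z → z * 2 ^ 2 ^ e * m ^ 2 ^ (j + e)) (^-*-assoc 2 (suc j) K) ⟩
  2 ^ (suc j * K) * 2 ^ 2 ^ e * m ^ 2 ^ (j + e)   ≡⟨ cong (_* m ^ 2 ^ (j + e)) (^-distribˡ-+-* 2 (suc j * K) (2 ^ e)) ⟨
  2 ^ (suc j * K + 2 ^ e) * m ^ 2 ^ (j + e)       ∎)
  where
  open ≤-Reasoning
  m = 2 ^ suc j
  U = length (filter (λ 𝓕 → size 𝓕 ≤? K) (setSystems (j + e)))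
  instance
    m≢0 : NonZero m
    m≢0 = m^n≢0 2 (suc j)
    m^≢0 : NonZero (m ^ 2 ^ (j + e))
    m^≢0 = m^n≢0 m (2 ^ (j + e))

-- With B the central binomial coefficient, both K and 2 ^ e are O(B / n²), so the
-- exponent in numSmall≤ is O(L B / n²), which is below c ≥ B / n.
module _ (D l j e K c : ℕ) (1+j≡3L : suc j ≡ 3 * suc l)
  (1≤n : 1 ≤ j + e) (n≤2^L : j + e ≤ 2 ^ suc l) (CL≤n : (300 + D) * suc l ≤ j + e)
  (K≤ : K * ((j + e) * (j + e)) ≤ 72 * ((j + e) C ⌊ j + e /2⌋))
  (B≤ : (j + e) C ⌊ j + e /2⌋ ≤ (j + e) * c) where

  private
    L = suc l
    N = j + e
    B = N C ⌊ N /2⌋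

    instance
      n≢0 : NonZero N
      n≢0 = >-nonZero 1≤n
      n²≢0 : NonZero (N * N)
      n²≢0 = m*n≢0 N N

    n+1≤2^L+1 : suc N ≤ 2 ^ suc L
    n+1≤2^L+1 = ≤-trans (+-mono-≤ (m^n>0 2 L) n≤2^L) (≤-reflexive (cong (2 ^ L +_) (sym (+-identityʳ (2 ^ L)))))

    aL≤n : ∀ a b → a + b ≡ 300 + D → a * L ≤ N
    aL≤n a b eq = ≤-trans (*-monoˡ-≤ L (m≤m+n a b)) (≤-trans (≤-reflexive (cong (_* L) eq)) CL≤n)

    -- B is at least 2^N / (N + 1), and N³ (N + 1) ≤ 2^(4L + 1) ≤ 2^(5L) ≤ 2^N. This absorbs the
    -- lower-order terms D + L + 1 of the exponent.
    n³≤B : N * N * N ≤ B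
    n³≤B = *-cancelʳ-≤ _ _ (suc N) (begin
      N * N * N * suc N
        ≤⟨ *-mono-≤ (*-mono-≤ (*-mono-≤ n≤2^L n≤2^L) n≤2^L) n+1≤2^L+1 ⟩
      2 ^ L * 2 ^ L * 2 ^ L * 2 ^ suc L
        ≡⟨ powers ⟩
      2 ^ (L + L + L + suc L)
        ≤⟨ ^-monoʳ-≤ 2 (≤-trans (m≤m+n (L + L + L + suc L) l) (≤-trans (≤-reflexive (five l)) (aL≤n 5 (295 + D) refl))) ⟩
      2 ^ N
        ≤⟨ 2^n≤[1+n]*nC⌊n/2⌋ N ⟩
      suc N * B
        ≡⟨ *-comm (suc N) B ⟩
      B * suc N ∎)
      where
      open ≤-Reasoning
      powers : 2 ^ L * 2 ^ L * 2 ^ L * 2 ^ suc L ≡ 2 ^ (L + L + L + suc L)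
      powers rewrite ^-distribˡ-+-* 2 (L + L + L) (suc L) | ^-distribˡ-+-* 2 (L + L) L
                   | ^-distribˡ-+-* 2 L L = refl
      five : ∀ l → (1 + l) + (1 + l) + (1 + l) + (2 + l) + l ≡ 5 * (1 + l)
      five = solve-∀

    -- Here j + 1 = 3L pays off: N³ ≤ 2^(j+1) gives N³ 2^e ≤ 2 * 2^N ≤ 4 N B. One factor N is spent
    -- on the crude bound for 2^N, and two remain.
    n²*2^e≤4B : N * N * 2 ^ e ≤ 4 * B
    n²*2^e≤4B = *-cancelˡ-≤ N (begin
      N * (N * N * 2 ^ e)
        ≡⟨ regroup N (2 ^ e) ⟩
      N * (N * (N * 1)) * 2 ^ e
        ≤⟨ *-monoˡ-≤ (2 ^ e) (^-monoˡ-≤ 3 n≤2^L) ⟩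
      (2 ^ L) ^ 3 * 2 ^ e
        ≡⟨ cong (_* 2 ^ e) (trans (^-*-assoc 2 L 3) (cong (2 ^_) (trans (*-comm L 3) (sym 1+j≡3L)))) ⟩
      2 ^ suc j * 2 ^ e
        ≡⟨ ^-distribˡ-+-* 2 (suc j) e ⟨
      2 * 2 ^ N
        ≤⟨ *-monoʳ-≤ 2 (2^n≤[1+n]*nC⌊n/2⌋ N) ⟩
      2 * (suc N * B)
        ≤⟨ *-monoʳ-≤ 2 (*-monoˡ-≤ B (+-monoˡ-≤ N 1≤n)) ⟩
      2 * ((N + N) * B)
        ≡⟨ collect N B ⟩
      N * (4 * B) ∎)
      where
      open ≤-Reasoning
      regroup : ∀ N a → N * (N * N * a) ≡ N * (N * (N * 1)) * a
      regroup = solve-∀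
      collect : ∀ N b → 2 * ((N + N) * b) ≡ N * (4 * b)
      collect = solve-∀

  -- After multiplication by N², the terms cost B, 3L * 72 B = 216 L B and 4 B. Together they are at
  -- most 221 L B ≤ N B ≤ N² c. The constant 300 + D leaves room for this 221 and for the D + 2
  -- needed by the first term.
  exponent≤ : D + suc L + (suc j * K + 2 ^ e) ≤ c
  exponent≤ = *-cancelˡ-≤ (N * N) (begin
    N * N * (D + suc L + (suc j * K + 2 ^ e))
      ≡⟨ cong (λ z → N * N * (D + suc L + (z * K + 2 ^ e))) 1+j≡3L ⟩
    N * N * (D + suc L + (3 * L * K + 2 ^ e))
      ≡⟨ expand N (D + suc L) L K (2 ^ e) ⟩
    N * N * (D + suc L) + 3 * L * (K * (N * N)) + N * N * 2 ^ e
      ≤⟨ +-mono-≤ (+-mono-≤ (≤-trans (*-monoʳ-≤ (N * N) D+L+1≤n) n³≤B) (*-monoʳ-≤ (3 * L) K≤)) n²*2^e≤4B ⟩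
    B + 3 * L * (72 * B) + 4 * B
      ≡⟨ collect L B ⟩
    (216 * L + 5) * B
      ≤⟨ *-monoˡ-≤ B (≤-trans (+-monoʳ-≤ (216 * L) (m≤m+n 5 (5 * l))) (≤-trans (≤-reflexive (221L l)) (aL≤n 221 (79 + D) refl))) ⟩
    N * B
      ≤⟨ *-monoʳ-≤ N B≤ ⟩
    N * (N * c)
      ≡⟨ *-assoc N N c ⟨
    N * N * c ∎)
    where
    open ≤-Reasoning
    expand : ∀ N d L K a → N * N * (d + (3 * L * K + a)) ≡ N * N * d + 3 * L * (K * (N * N)) + N * N * a
    expand = solve-∀
    collect : ∀ L b → b + 3 * L * (72 * b) + 4 * b ≡ (216 * L + 5) * b
    collect = solve-∀
    221L : ∀ l → 216 * (1 + l) + (5 + 5 * l) ≡ 221 * (1 + l)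
    221L = solve-∀
    D+L+1≤n : D + suc L ≤ N
    D+L+1≤n = ≤-trans (≤-trans (m≤m+n (D + suc L) (l + D * l)) (≤-reflexive (factor D l))) (aL≤n (2 + D) 298 (+-comm (2 + D) 298))
      where
      factor : ∀ D l → D + (2 + l) + (l + D * l) ≡ (2 + D) * (1 + l)
      factor = solve-∀

  D*[1+n]*2^≤2^c : D * (suc (j + e) * 2 ^ (suc j * K + 2 ^ e)) ≤ 2 ^ c
  D*[1+n]*2^≤2^c = begin
    D * (suc N * 2 ^ E)                   ≤⟨ *-mono-≤ (<⇒≤ (n<2^n D)) (*-monoˡ-≤ (2 ^ E) n+1≤2^L+1) ⟩
    2 ^ D * (2 ^ suc L * 2 ^ E)           ≡⟨ *-assoc (2 ^ D) (2 ^ suc L) (2 ^ E) ⟨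
    2 ^ D * 2 ^ suc L * 2 ^ E             ≡⟨ cong (_* 2 ^ E) (^-distribˡ-+-* 2 D (suc L)) ⟨
    2 ^ (D + suc L) * 2 ^ E               ≡⟨ ^-distribˡ-+-* 2 (D + suc L) E ⟨
    2 ^ (D + suc L + E)                   ≤⟨ ^-monoʳ-≤ 2 exponent≤ ⟩
    2 ^ c                                 ∎
    where
    open ≤-Reasoning
    E = suc j * K + 2 ^ e

module _ (D n l : ℕ) (2≤n : 2 ≤ n) (n≤2^L : n ≤ 2 ^ suc l) (CL≤n : (300 + D) * suc l ≤ n) where

  private
    L = suc l
    B = n C ⌊ n /2⌋
    instance
      n≢0 : NonZero n
      n≢0 = >-nonZero (≤-trans (s≤s z≤n) 2≤n)
      n²≢0 : NonZero (n * n)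
      n²≢0 = m*n≢0 n n
    K = 72 * B / (n * n)
    j = pred (3 * L)

    aL≤n : ∀ a b → a + b ≡ 300 + D → a * L ≤ n
    aL≤n a b eq = ≤-trans (*-monoˡ-≤ L (m≤m+n a b)) (≤-trans (≤-reflexive (cong (_* L) eq)) CL≤n)

    j≤n : j ≤ n
    j≤n = ≤-trans pred[n]≤n (aL≤n 3 (297 + D) refl)

    small : ∀ {M : SetSystem n} → IsSparsePaving M → ¬ (HasMinor 𝒲³ M ⊎ HasMinor M[K₄] M) →
            size (nonbases (rank M ⊤) M) ≤ K
    small {M} sp no-minor = begin
      s                         ≡⟨ m*n/n≡m s (n * n) ⟨
      s * (n * n) / (n * n)     ≡⟨ cong (_/ (n * n)) (*-comm s (n * n)) ⟩
      n * n * s / (n * n)       ≤⟨ /-monoˡ-≤ (n * n) (n²*size-nonbases≤72*central n≤2^L (aL≤n 12 (288 + D) refl) sp no-minor) ⟩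
      K                         ∎
      where
      open ≤-Reasoning
      s = size (nonbases (rank M ⊤) M)

  D*numSparsePaving-𝒳≤ : ∀ c → n C ⌊ n /2⌋ ≤ n * c → D * numSparsePaving-𝒳 n ≤ 2 ^ c
  D*numSparsePaving-𝒳≤ c B≤ = ≤-trans (*-monoʳ-≤ D (≤-trans (numSparsePaving-𝒳-upper n K small)
      (*-monoʳ-≤ (suc n) (subst (λ z → length (filter (λ 𝓕 → size 𝓕 ≤? K) (setSystems z)) ≤ 2 ^ (suc j * K + 2 ^ (n ∸ j)))
        j+e≡n (numSmall≤ j (n ∸ j) K)))))
      (transported (n ∸ j) j+e≡n c B≤)
    where
    j+e≡n : j + (n ∸ j) ≡ n
    j+e≡n = m+[n∸m]≡n j≤n
    -- The estimates are phrased for j + e, where 2^(j+e) splits; they are carried back to n along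
    -- the equation.
    transported : ∀ e → j + e ≡ n → ∀ c → B ≤ n * c → D * (suc n * 2 ^ (suc j * K + 2 ^ e)) ≤ 2 ^ c
    transported e eq c B≤ = subst (λ z → D * (suc z * 2 ^ (suc j * K + 2 ^ e)) ≤ 2 ^ c) eq
      (D*[1+n]*2^≤2^c D l j e K c refl
        (subst (1 ≤_) (sym eq) (≤-trans (s≤s z≤n) 2≤n))
        (subst (_≤ 2 ^ L) (sym eq) n≤2^L)
        (subst ((300 + D) * L ≤_) (sym eq) CL≤n)
        (subst (λ z → K * (z * z) ≤ 72 * (z C ⌊ z /2⌋)) (sym eq) (m/n*n≤m (72 * B) (n * n)))
        (subst (λ z → z C ⌊ z /2⌋ ≤ z * c) (sym eq) B≤))

D*numSparsePaving-𝒳≤numSparsePaving : ∀ D n L → 2 ≤ n → n ≤ 2 ^ L → (300 + D) * L ≤ n →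
                                      D * numSparsePaving-𝒳 n ≤ numSparsePaving n
D*numSparsePaving-𝒳≤numSparsePaving D n       zero    2≤n n≤1   _    = contradiction (≤-trans 2≤n n≤1) (<⇒≱ ≤-refl)
D*numSparsePaving-𝒳≤numSparsePaving D (suc m) (suc l) 2≤n n≤2^L CL≤n = ≤-trans
  (D*numSparsePaving-𝒳≤ D (suc m) l 2≤n n≤2^L CL≤n (proj₁ lower) (proj₁ (proj₂ lower)))
  (proj₂ (proj₂ lower))
  where
  -- With n ≥ 2 the middle rank lies strictly between 0 and n.
  lower = numSparsePaving-lower m ⌊ suc m /2⌋ (⌊n/2⌋-mono 2≤n) (⌊n/2⌋<n m)

-- From constant factors to little-o

-- Since (p + 1) / (q + 1) ≥ 1 / (q + 1), the denominator of ε serves as the constant factor D.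
≤-scaled : ∀ p q .{c : Coprime (suc p) (suc q)} (a b : ℕ) → suc q * a ≤ b → ℤ.+ a ℚ./ 1 ℚ.≤ ℚ.mkℚ +[1+ p ] q c ℚ.* (ℤ.+ b ℚ./ 1)
≤-scaled p q {c} a b qa≤b = ℚ.toℚᵘ-cancel-≤ (ℚᵘ.≤-respˡ-≃ (ℚᵘ.≃-sym (ℚ.toℚᵘ-fromℚᵘ (ℚᵘ.mkℚᵘ (ℤ.+ a) 0)))
  (ℚᵘ.≤-respʳ-≃ (ℚᵘ.≃-sym (ℚᵘ.≃-trans (ℚ.toℚᵘ-homo-* ε (ℤ.+ b ℚ./ 1))
    (ℚᵘ.*-congˡ {ℚ.toℚᵘ ε} (ℚ.toℚᵘ-fromℚᵘ (ℚᵘ.mkℚᵘ (ℤ.+ b) 0)))))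
    (ℚᵘ.*≤* cross)))
  where
  ε = ℚ.mkℚ +[1+ p ] q c
  cross : ℤ.+ a ℤ.* (ℤ.+ (suc q * 1)) ℤ.≤ +[1+ p ] ℤ.* ℤ.+ b ℤ.* ℤ.+ 1
  cross rewrite sym (ℤ.pos-* a (suc q * 1)) | sym (ℤ.pos-* (suc p) b) | sym (ℤ.pos-* (suc p * b) 1) =
    ℤ.+≤+ (begin
      a * (suc q * 1)   ≡⟨ cong (a *_) (*-identityʳ (suc q)) ⟩
      a * suc q         ≡⟨ *-comm a (suc q) ⟩
      suc q * a         ≤⟨ qa≤b ⟩
      b                 ≤⟨ m≤n*m b (suc p) ⟩
      suc p * b         ≡⟨ *-identityʳ (suc p * b) ⟨
      suc p * b * 1     ∎)
    where open ≤-Reasoning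

=o-intro : {f g : ℕ → ℕ} → (∀ D → ∃[ n₀ ] (∀ n → n₀ ≤ n → D * f n ≤ g n)) → f =o g
=o-intro         eventually (ℚ.mkℚ (ℤ.+ zero) q c) (ℚ.*<* (ℤ.+<+ ()))
=o-intro         eventually (ℚ.mkℚ -[1+ p ]   q c) (ℚ.*<* ())
=o-intro {f} {g} eventually (ℚ.mkℚ +[1+ p ]   q c) _ =
  proj₁ (eventually (suc q)) ,
  λ n n₀≤n → ≤-scaled p q {c} (f n) (g n) (proj₂ (eventually (suc q)) n n₀≤n)

theorem7 : numSparsePaving-𝒳 =o numSparsePaving
theorem7 = =o-intro {numSparsePaving-𝒳} {numSparsePaving} λ D → eventually D (log-sublinear (300 + D))
  where
  eventually : ∀ D → ∃[ n₀ ] (∀ n → n₀ ≤ n → ∃[ L ] (n ≤ 2 ^ L × (300 + D) * L ≤ n)) →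
               ∃[ n₀ ] (∀ n → n₀ ≤ n → D * numSparsePaving-𝒳 n ≤ numSparsePaving n)
  eventually D (n₀ , bound) = 2 ⊔ n₀ , λ n 2⊔n₀≤n →
    let L , n≤2^L , CL≤n = bound n (m⊔n≤o⇒n≤o 2 n₀ 2⊔n₀≤n)
    in D*numSparsePaving-𝒳≤numSparsePaving D n L (m⊔n≤o⇒m≤o 2 n₀ 2⊔n₀≤n) n≤2^L CL≤n
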